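{- Let $n\ge 6$ be an even integer, let $c$ be an integer with $1<c<n/2$, let $S=\{\pm 1,\pm c,n/2\}\subseteq\mathbb{Z}_n$, and assume that $\Gamma=\mathrm{Cay}(\mathbb{Z}_n;S)$ is closed distance magic. Write $n=2^t\ell$, $c+1=2^\alpha\ell_1$ and $c-1=2^\beta\ell_2$, where $t,\alpha,\beta$ are non-negative integers and $\ell,\ell_1,\ell_2$ are odd positive integers. For $i\in\{1,2\}$ let $d_i=\gcd(\ell,\ell_i)$ and let $n_i$ be the positive integer with $\ell=d_in_i$. Assume that there exists $j\in\mathcal{J}_n(S)$ of type $2$. Then $\ell=d_1d_2$. Consequently, $n=2^td_1d_2$, $n_1=d_2$ and $n_2=d_1$.
   Context: $\mathrm{Cay}(\mathbb{Z}_n;S)$ is the graph with vertex set $\mathbb{Z}_n$ in which $g,h$ are adjacent iff $h-g\in S$. A graph $\Gamma=(V,E)$ of order $n$ is closed distance magic if there are a bijection $\ell:V\to\{1,\ldots,n\}$ and a positive integer $r$ such that for all $u\in V$ the sum of the labels of $u$ and all its neighbors equals $r$. For $0\le j\le n-1$ let $\chi_j(x)=\cos(2\pi xj/n)+\mathbf{i}\sin(2\pi xj/n)$ and $\chi_j(S)=\sum_{x\in S}\chi_j(x)$; $\mathcal{J}_n(S)$ is the set of $j\in\{0,\ldots,n-1\}$ with $\chi_j(S)=-1$. An even $j\in\mathcal{J}_n(S)$ is of type $2$ if $\{\frac{2\pi j}{n},\frac{2\pi jc}{n}\}=\{\pm\frac{2\pi}{3}+2k_1\pi,\pm\frac{2\pi}{3}+2k_2\pi\}$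 for some $k_1,k_2\in\mathbb{Z}$ and some (independent) choice of signs. -}

module Defs where

open import Algebra.Definitions.RawSemiring using () renaming (_^_ to pow)
open import Data.Fin as Fin using (Fin; toℕ; fromℕ<)
open import Data.Fin.Subset using (Subset; _∈_; _∪_; ⁅_⁆)
open import Data.Fin.Subset.Properties using (_∈?_)
open import Data.Integer as ℤ using (ℤ; +_; _◃_)
open import Data.Integer.DivMod using (n%ℕd<d)
open import Data.List using (map; filter; foldr; allFin)
open import Data.Nat as ℕ using (ℕ; zero; suc; NonZero; _!)
open import Data.Nat.Divisibility using (_∣_)
open import Data.Nat.ListAction using (sum)
open import Data.Nat.Properties using (_!≢0)
open import Data.Product using (_×_; ∃-syntax; Σ-syntax)
open import Data.Rational.Base as ℚ using (ℚ; 0ℚ; 1ℚ; _/_; ∣_∣; +-*-rawSemiring)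
open import Data.Sign using (Sign)
open import Data.Sum using (_⊎_)
open import Function.Bundles using (_⤖_; module Bijection)
open import Relation.Binary using (Decidable)
open import Relation.Binary.PropositionalEquality using (_≡_)
open import Relation.Nullary.Decidable using (_⊎-dec_)
open import Relation.Unary using (Pred; _≐_)
open import Level using (0ℓ)

------------------------------------------------------------------------
-- Real and complex numbers

-- A real number is presented by a sequence of rationals converging to it.
-- No Cauchy proof is carried along, since _≈_ (the difference tends to 0)
-- is the equality of the limits whenever both sequences converge, and
-- every sequence built below does converge.
ℝ : Set
ℝ = ℕ → ℚ

infix 4 _≈_ _≈ᶜ_
infixl 6 _+ᴿ_ _+ᶜ_

_≈_ : ℝ → ℝ → Set
x ≈ y = ∀ (ε : ℚ) → 0ℚ ℚ.< ε →
        ∃[ N ] (∀ m → N ℕ.≤ m → ∣ x m ℚ.- y m ∣ ℚ.< ε)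

fromℚ : ℚ → ℝ
fromℚ q _ = q

_+ᴿ_ : ℝ → ℝ → ℝ
(x +ᴿ y) m = x m ℚ.+ y m

_*ᴿ_ : ℝ → ℝ → ℝ
(x *ᴿ y) m = x m ℚ.* y m

infixl 7 _*ᴿ_

infixr 8 _^_
_^_ : ℚ → ℕ → ℚ
_^_ = pow +-*-rawSemiring

Σ≤ : ℕ → (ℕ → ℚ) → ℚ
Σ≤ zero    f = f 0
Σ≤ (suc m) f = Σ≤ m f ℚ.+ f (suc m)

_/!_ : ℤ → ℕ → ℚ
a /! k = (a / (k !)) {{k !≢0}}

-- Euler's series  π = Σₖ 2ᵏ⁺¹ (k!)² / (2k+1)!
π : ℝ
π m = Σ≤ m λ k → (+ (2 ℕ.^ suc k ℕ.* (k !) ℕ.* (k !))) /! suc (2 ℕ.* k)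

-- The m-th approximation of cos x (and of sin x) is the m-th partial sum
-- of the Taylor series, evaluated at the m-th approximation of x. It
-- converges to the right value because the series converges uniformly on
-- bounded sets.
cos sin : ℝ → ℝ
cos x m = Σ≤ m λ k →
  (ℚ.- 1ℚ) ^ k ℚ.* x m ^ (2 ℕ.* k) ℚ.* ((+ 1) /! (2 ℕ.* k))
sin x m = Σ≤ m λ k →
  (ℚ.- 1ℚ) ^ k ℚ.* x m ^ suc (2 ℕ.* k) ℚ.* ((+ 1) /! suc (2 ℕ.* k))

record ℂ : Set where
  constructor _+i_
  field
    re im : ℝ
open ℂ public

_≈ᶜ_ : ℂ → ℂ → Set
z ≈ᶜ w = re z ≈ re w × im z ≈ im w

_+ᶜ_ : ℂ → ℂ → ℂ
z +ᶜ w = (re z +ᴿ re w) +i (im z +ᴿ im w)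

0ᶜ -1ᶜ : ℂ
0ᶜ  = fromℚ 0ℚ +i fromℚ 0ℚ
-1ᶜ = fromℚ (ℚ.- 1ℚ) +i fromℚ 0ℚ

⟪_,_⟫ : ℝ → ℝ → Pred ℝ 0ℓ
⟪ x , y ⟫ z = z ≈ x ⊎ z ≈ y

------------------------------------------------------------------------
-- Graphs and closed distance magic labelings

record Graph (n : ℕ) : Set₁ where
  field
    Adj  : Fin n → Fin n → Set
    adj? : Decidable Adj

-- The label of v is suc (toℕ (f v)), so f is a bijection onto {1, …, n}.
ClosedDistanceMagic : ∀ {n} → Graph n → Set
ClosedDistanceMagic {n} Γ =
  Σ[ f ∈ Fin n ⤖ Fin n ] ∃[ r ] (0 ℕ.< r × (∀ u →
    sum (map (λ v → suc (toℕ (Bijection.to f v)))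
             (filter (λ v → (v Fin.≟ u) ⊎-dec adj? u v) (allFin n))) ≡ r))
  where open Graph Γ

-- ±2π/3 + 2kπ, the sign being s
thirdTurn : Sign → ℤ → ℝ
thirdTurn s k = fromℚ ((s ◃ 2) / 3) *ᴿ π +ᴿ fromℚ ((+ 2 ℤ.* k) / 1) *ᴿ π

------------------------------------------------------------------------
-- Circulants; ℤ/n is represented by Fin n

module _ (n : ℕ) .{{_ : NonZero n}} where

  residue : ℤ → Fin n
  residue a = fromℕ< (n%ℕd<d a n)

  -- This is an undirected loopless graph when S = - S and 0 ∉ S.
  Cay : Subset n → Graph n
  Cay S = record
    { Adj  = λ g h → diff g h ∈ S
    ; adj? = λ g h → diff g h ∈? S
    }
    where
    diff : Fin n → Fin n → Fin n
    diff g h = residue (+ toℕ h ℤ.- + toℕ g)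

  -- {±1, ±c, n/2}; the quotient is exact for even n.
  connectionSet : ℕ → Subset n
  connectionSet c =
    ⁅ residue (+ 1) ⁆ ∪ ⁅ residue (ℤ.- + 1) ⁆ ∪
    ⁅ residue (+ c) ⁆ ∪ ⁅ residue (ℤ.- + c) ⁆ ∪
    ⁅ residue (+ (n ℕ./ 2)) ⁆

  -- 2πa/n
  angle : ℕ → ℝ
  angle a = fromℚ (+ (2 ℕ.* a) / n) *ᴿ π

  χ : Fin n → Fin n → ℂ
  χ j x = cos (angle (toℕ x ℕ.* toℕ j)) +i sin (angle (toℕ x ℕ.* toℕ j))

  χ-sum : Fin n → Subset n → ℂ
  χ-sum j S = foldr (λ x z → χ j x +ᶜ z) 0ᶜ (filter (_∈? S) (allFin n))

  𝒥 : Subset n → Pred (Fin n) 0ℓ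
  𝒥 S j = χ-sum j S ≈ᶜ -1ᶜ

  Type2 : ℕ → Pred (Fin n) 0ℓ
  Type2 c j =
    𝒥 (connectionSet c) j × 2 ∣ toℕ j ×
    ∃[ s₁ ] ∃[ s₂ ] ∃[ k₁ ] ∃[ k₂ ]
      (⟪ angle (toℕ j) , angle (toℕ j ℕ.* c) ⟫ ≐
       ⟪ thirdTurn s₁ k₁ , thirdTurn s₂ k₂ ⟫)

{-# OPTIONS --safe #-}

-- Let f : ℤ → ℤ be the labelling, n-periodic and injective modulo n. If ℓ ≠ d₁d₂, some prime p divides
-- ℓ/(d₁d₂); we show that f then has period P = n/p, a contradiction. Let T be the translation by 1.
--
-- * f⁻ = (1 − T^(n/2)) f is killed by T + T⁻¹ + T^c + T^(−c), which is (1 + T^(c−1)) (1 + T^(c+1)) up to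
--   a unit. Since gcd (n, 2(c ± 1)) divides P, (1 − T^P)² kills f⁻, hence so does 1 − T^P.
-- * g = (T^P − 1)(1 + T^(n/2)) f is killed by D(T) = 2 + T + T⁻¹ + T^c + T^(−c). Instead of
--   classifying the solutions of cos a + cos b = −1 we use a Galois argument: for a prime q ≥ 7,
--   D(T)^q ≡ D(T^q) modulo q shows that D(T^q) g is q times an integral function of smaller sup norm in
--   the kernel of D(T), so by descent D(T^q)² g = 0, and D(T^q) g = 0 because D(T^q) is self-adjoint.
--   Hence D(T^k) g = 0 for all k prime to 30. As the sum of g over every coset of the subgroup of order
--   p vanishes, averaging these relations over k = 1 + iwP isolates single terms of D, and g = 0.
--
-- The type 2 hypothesis enters only through 3 ∣ n and 3 ∤ c, which give 3 ∣ P.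

module Submission where

module Periodic where

  open import Data.Empty using (⊥-elim)
  open import Data.Integer hiding (suc)
  open import Data.Integer.DivMod using (_%ℕ_; _/ℕ_; n%ℕd<d; a≡a%ℕn+[a/ℕn]*n)
  open import Data.Integer.Divisibility.Signed
  open import Data.Integer.Properties
  open import Data.Integer.Tactic.RingSolver using (solve-∀)
  open import Data.List using (List; []; _∷_; map; length)
  open import Data.List.Properties using (map-∘; map-cong; map-id; length-map)
  open import Data.List.Relation.Unary.All using (All; []; _∷_)
  open import Data.Nat as ℕ using (ℕ; zero; suc; _∸_; s≤s; z≤n)
  open import Data.Nat.Combinatorics using (_C_; nCk+nC[k+1]≡[n+1]C[k+1]; nC1≡n; k>n⇒nCk≡0; nCn≡1)
  open import Data.Nat.Coprimality using (Coprime; coprime⇒gcd≡1)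
  import Data.Nat.Divisibility as ℕ
  import Data.Nat.DivMod as ℕ
  open import Data.Nat.GCD using (gcd; gcd-GCD; c*gcd[m,n]≡gcd[cm,cn]; module Bézout)
  open import Data.Nat.ListAction using (product)
  open import Data.Nat.Primality
    using (Prime; prime?; prime⇒nonZero; prime⇒irreducible; euclidsLemma; ¬prime[0]; ¬prime[1])
  open import Data.Nat.Primality.Factorisation using (PrimeFactorisation; factorise)
  import Data.Nat.Properties as ℕ
  import Data.Nat.Tactic.RingSolver as ℕ
  open import Data.Product using (_×_; _,_; ∃-syntax)
  open import Data.Sum using (inj₁; inj₂; reduce)
  open import Function using (_∘_)
  open import Relation.Binary.PropositionalEquality
  open import Relation.Nullary using (¬_; Dec; yes; no)
  open import Relation.Nullary.Decidable using (from-no; from-yes)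
  open ≡-Reasoning

  Period : ℤ → (ℤ → ℤ) → Set
  Period a f = ∀ x → f (x + a) ≡ f x

  module _ {f : ℤ → ℤ} where

    period-0 : Period 0ℤ f
    period-0 x = cong f (+-identityʳ x)

    period-+ : ∀ {a b} → Period a f → Period b f → Period (a + b) f
    period-+ {a} {b} pa pb x =
      trans (cong f (sym (+-assoc x a b))) (trans (pb (x + a)) (pa x))

    period-neg : ∀ {a} → Period a f → Period (- a) f
    period-neg {a} pa x = trans (sym (pa (x + - a))) (cong f (lemma x a))
      where
      lemma : ∀ x a → x + - a + a ≡ x
      lemma = solve-∀

    period-ℕ* : ∀ k {a} → Period a f → Period (+ k * a) f
    period-ℕ* zero    {a} pa = subst (λ b → Period b f) (sym (*-zeroˡ a)) period-0
    period-ℕ* (suc k) {a} pa =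
      subst (λ b → Period b f) (sym (suc-* (+ k) a)) (period-+ pa (period-ℕ* k pa))

    period-* : ∀ k {a} → Period a f → Period (k * a) f
    period-* (+ k)    pa = period-ℕ* k pa
    period-* -[1+ k ] {a} pa =
      subst (λ b → Period b f) (neg-distribˡ-* (+ suc k) a) (period-neg (period-ℕ* (suc k) pa))

    period-∣ : ∀ {m n} → m ℕ.∣ n → Period (+ m) f → Period (+ n) f
    period-∣ {m} (ℕ.divides k refl) pm =
      subst (λ b → Period b f) (sym (pos-* k m)) (period-ℕ* k pm)

    period-gcd : ∀ {m n} → Period (+ m) f → Period (+ n) f → Period (+ gcd m n) f
    period-gcd {m} {n} pm pn with Bézout.identity (gcd-GCD m n)
    ... | Bézout.+- x y eq = λ z → trans (sym (period-ℕ* y pn (z + + gcd m n)))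
            (trans (cong f (shift z (gcd m n) x y m n eq)) (period-ℕ* x pm z))
      where
      shift : ∀ z d x y m n → d ℕ.+ y ℕ.* n ≡ x ℕ.* m →
              z + + d + + y * + n ≡ z + + x * + m
      shift z d x y m n eq = trans (+-assoc z (+ d) _) (cong (λ y → z + y)
        (trans (cong (λ y → + d + y) (sym (pos-* y n))) (trans (cong +_ eq) (pos-* x m))))
    ... | Bézout.-+ x y eq = λ z → trans (sym (period-ℕ* x pm (z + + gcd m n)))
            (trans (cong f (shift z (gcd m n) x y m n eq)) (period-ℕ* y pn z))
      where
      shift : ∀ z d x y m n → d ℕ.+ x ℕ.* m ≡ y ℕ.* n →
              z + + d + + x * + m ≡ z + + y * + n
      shift z d x y m n eq = trans (+-assoc z (+ d) _) (cong (λ y → z + y)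
        (trans (cong (λ y → + d + y) (sym (pos-* x m))) (trans (cong +_ eq) (pos-* y n))))

    period-∣a∣ : ∀ a → Period a f → Period (+ ∣ a ∣) f
    period-∣a∣ (+ a)    p = p
    period-∣a∣ -[1+ a ] p = period-neg p

  -- Translate sums: as stands for the element Σ T^a of the group ring of ℤ.
  shifts : List ℤ → (ℤ → ℤ) → ℤ → ℤ
  shifts []       f x = 0ℤ
  shifts (a ∷ as) f x = f (x + a) + shifts as f x

  private
    swap+ : ∀ a b c d → (a + b) + (c + d) ≡ (a + c) + (b + d)
    swap+ = solve-∀
    comm3 : ∀ x a b → x + a + b ≡ x + b + a
    comm3 = solve-∀

  shifts-cong : ∀ as {f g} → (∀ x → f x ≡ g x) → ∀ x → shifts as f x ≡ shifts as g x
  shifts-cong []       eq x = refl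
  shifts-cong (a ∷ as) eq x = cong₂ _+_ (eq (x + a)) (shifts-cong as eq x)

  shifts-0 : ∀ as {f} → (∀ x → f x ≡ 0ℤ) → ∀ x → shifts as f x ≡ 0ℤ
  shifts-0 []       eq x = refl
  shifts-0 (a ∷ as) eq x = cong₂ _+_ (eq (x + a)) (shifts-0 as eq x)

  shifts-+ : ∀ as f g x →
    shifts as (λ y → f y + g y) x ≡ shifts as f x + shifts as g x
  shifts-+ []       f g x = refl
  shifts-+ (a ∷ as) f g x = trans (cong (λ z → f (x + a) + g (x + a) + z) (shifts-+ as f g x))
    (swap+ (f (x + a)) (g (x + a)) (shifts as f x) (shifts as g x))

  shifts-* : ∀ as k f x → shifts as (λ y → k * f y) x ≡ k * shifts as f x
  shifts-* []       k f x = sym (*-zeroʳ k)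
  shifts-* (a ∷ as) k f x = trans (cong (λ z → k * f (x + a) + z) (shifts-* as k f x))
    (sym (*-distribˡ-+ k (f (x + a)) (shifts as f x)))

  shifts-translate : ∀ as f b x → shifts as (λ y → f (y + b)) x ≡ shifts as f (x + b)
  shifts-translate []       f b x = refl
  shifts-translate (a ∷ as) f b x =
    cong₂ _+_ (cong f (comm3 x a b)) (shifts-translate as f b x)

  shifts-comm : ∀ as bs f x → shifts as (shifts bs f) x ≡ shifts bs (shifts as f) x
  shifts-comm []       bs f x = sym (shifts-0 bs (λ _ → refl) x)
  shifts-comm (a ∷ as) bs f x = begin
    shifts bs f (x + a) + shifts as (shifts bs f) x
      ≡⟨ cong₂ _+_ (sym (shifts-translate bs f a x)) (shifts-comm as bs f x) ⟩
    shifts bs (λ y → f (y + a)) x + shifts bs (shifts as f) x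
      ≡⟨ sym (shifts-+ bs _ _ x) ⟩
    shifts bs (shifts (a ∷ as) f) x ∎

  shifts-period : ∀ as {n f} → Period n f → Period n (shifts as f)
  shifts-period as {n} {f} p x = trans (sym (shifts-translate as f n x)) (shifts-cong as p x)

  shifts-bound : ∀ as {f} B → (∀ x → ∣ f x ∣ ℕ.≤ B) →
                 ∀ x → ∣ shifts as f x ∣ ℕ.≤ length as ℕ.* B
  shifts-bound []       B fB x = ℕ.z≤n
  shifts-bound (a ∷ as) {f} B fB x = ℕ.≤-trans (∣i+j∣≤∣i∣+∣j∣ (f (x + a)) _)
    (ℕ.+-mono-≤ (fB (x + a)) (shifts-bound as B fB x))
    where import Data.Nat.Properties as ℕₚ

  absorption : ∀ n k → suc k ℕ.* (suc n C suc k) ≡ suc n ℕ.* (n C k)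
  absorption n       zero    = trans (ℕ.*-identityˡ _) (trans (nC1≡n (suc n)) (sym (ℕ.*-identityʳ _)))
  absorption zero    (suc k) = trans (cong (suc (suc k) ℕ.*_) (k>n⇒nCk≡0 {1} {suc (suc k)} (s≤s (s≤s z≤n))))
    (trans (ℕ.*-zeroʳ (suc (suc k))) (sym (trans (ℕ.*-identityˡ _) (k>n⇒nCk≡0 {0} {suc k} (s≤s z≤n)))))
  absorption (suc n) (suc k) = begin
    suc (suc k) ℕ.* (suc (suc n) C suc (suc k))
      ≡⟨ cong (suc (suc k) ℕ.*_) (sym (nCk+nC[k+1]≡[n+1]C[k+1] (suc n) (suc k))) ⟩
    suc (suc k) ℕ.* ((suc n C suc k) ℕ.+ (suc n C suc (suc k)))
      ≡⟨ split (suc k) (suc n C suc k) (suc n C suc (suc k)) ⟩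
    (suc n C suc k) ℕ.+ (suc k ℕ.* (suc n C suc k) ℕ.+ suc (suc k) ℕ.* (suc n C suc (suc k)))
      ≡⟨ cong ((suc n C suc k) ℕ.+_) (cong₂ ℕ._+_ (absorption n k) (absorption n (suc k))) ⟩
    (suc n C suc k) ℕ.+ (suc n ℕ.* (n C k) ℕ.+ suc n ℕ.* (n C suc k))
      ≡⟨ cong ((suc n C suc k) ℕ.+_) (sym (ℕ.*-distribˡ-+ (suc n) (n C k) (n C suc k))) ⟩
    (suc n C suc k) ℕ.+ suc n ℕ.* ((n C k) ℕ.+ (n C suc k))
      ≡⟨ cong (λ z → (suc n C suc k) ℕ.+ suc n ℕ.* z) (nCk+nC[k+1]≡[n+1]C[k+1] n k) ⟩
    suc (suc n) ℕ.* (suc n C suc k) ∎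
    where
    split : ∀ k a b → suc k ℕ.* (a ℕ.+ b) ≡ a ℕ.+ (k ℕ.* a ℕ.+ suc k ℕ.* b)
    split = ℕ.solve-∀

  prime∣C : ∀ {q} → Prime q → ∀ k → suc k ℕ.< q → q ℕ.∣ q C suc k
  prime∣C {suc q} pq k k<q with euclidsLemma (suc k) (suc q C suc k) pq
    (subst (suc q ℕ.∣_) (sym (absorption q k)) (ℕ.m∣m*n _))
  ... | inj₁ q∣k = ⊥-elim (ℕ.<⇒≱ k<q (ℕ.∣⇒≤ q∣k))
  ... | inj₂ q∣C = q∣C

  Σ< : ℕ → (ℕ → ℤ) → ℤ
  Σ< zero    f = 0ℤ
  Σ< (suc n) f = f n + Σ< n f

  Σ<-cong : ∀ n {f g} → (∀ i → i ℕ.< n → f i ≡ g i) → Σ< n f ≡ Σ< n g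
  Σ<-cong zero    eq = refl
  Σ<-cong (suc n) eq = cong₂ _+_ (eq n ℕ.≤-refl) (Σ<-cong n (λ i i<n → eq i (ℕ.m≤n⇒m≤1+n i<n)))

  Σ<-+ : ∀ n f g → Σ< n (λ i → f i + g i) ≡ Σ< n f + Σ< n g
  Σ<-+ zero    f g = refl
  Σ<-+ (suc n) f g = trans (cong (λ z → f n + g n + z) (Σ<-+ n f g)) (swap+ (f n) (g n) (Σ< n f) (Σ< n g))

  Σ<-0 : ∀ n {f} → (∀ i → i ℕ.< n → f i ≡ 0ℤ) → Σ< n f ≡ 0ℤ
  Σ<-0 zero    eq = refl
  Σ<-0 (suc n) eq = cong₂ _+_ (eq n ℕ.≤-refl) (Σ<-0 n (λ i i<n → eq i (ℕ.m≤n⇒m≤1+n i<n)))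

  Σ<-head : ∀ n f → Σ< (suc n) f ≡ f 0 + Σ< n (λ i → f (suc i))
  Σ<-head zero    f = refl
  Σ<-head (suc n) f = trans (cong (λ z → f (suc n) + z) (Σ<-head n f)) (swap (f (suc n)) (f 0) (Σ< n (λ i → f (suc i))))
    where
    swap : ∀ a b c → a + (b + c) ≡ b + (a + c)
    swap = solve-∀

  Σ<-∣ : ∀ n {f} {d} → (∀ i → i ℕ.< n → d ∣ f i) → d ∣ Σ< n f
  Σ<-∣ zero    h = divides 0ℤ refl
  Σ<-∣ (suc n) h = ∣m∣n⇒∣m+n (h n ℕ.≤-refl) (Σ<-∣ n (λ i i<n → h i (ℕ.m≤n⇒m≤1+n i<n)))

  -- pascal m H is ((1 + E)^m H) 0, where E is the forward shift.
  pascal : ℕ → (ℕ → ℤ) → ℤ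
  pascal zero    H = H 0
  pascal (suc m) H = pascal m (λ i → H (suc i)) + pascal m H

  pascal-cong : ∀ m {H K} → (∀ i → i ℕ.≤ m → H i ≡ K i) → pascal m H ≡ pascal m K
  pascal-cong zero    eq = eq 0 z≤n
  pascal-cong (suc m) eq = cong₂ _+_ (pascal-cong m (λ i i≤m → eq (suc i) (s≤s i≤m)))
                                     (pascal-cong m (λ i i≤m → eq i (ℕ.m≤n⇒m≤1+n i≤m)))

  pascal-+ : ∀ m H K → pascal m (λ i → H i + K i) ≡ pascal m H + pascal m K
  pascal-+ zero    H K = refl
  pascal-+ (suc m) H K = trans (cong₂ _+_ (pascal-+ m (λ i → H (suc i)) (λ i → K (suc i))) (pascal-+ m H K))
    (swap+ (pascal m (λ i → H (suc i))) (pascal m (λ i → K (suc i))) (pascal m H) (pascal m K))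

  pascal-binomial : ∀ m H → pascal m H ≡ Σ< (suc m) (λ k → + (m C k) * H k)
  pascal-binomial zero    H = sym (trans (+-identityʳ _) (*-identityˡ (H 0)))
  pascal-binomial (suc m) H = begin
    pascal m (λ i → H (suc i)) + pascal m H
      ≡⟨ cong₂ _+_ (pascal-binomial m _) (pascal-binomial m H) ⟩
    Σ< (suc m) (λ k → + (m C k) * H (suc k)) + Σ< (suc m) (λ k → + (m C k) * H k)
      ≡⟨ cong (λ z → Σ< (suc m) (λ k → + (m C k) * H (suc k)) + z) extend ⟩
    Σ< (suc m) (λ k → + (m C k) * H (suc k)) + (+ 1 * H 0 + Σ< (suc m) (λ k → + (m C suc k) * H (suc k)))
      ≡⟨ swap (Σ< (suc m) (λ k → + (m C k) * H (suc k))) (+ 1 * H 0) (Σ< (suc m) (λ k → + (m C suc k) * H (suc k))) ⟩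
    + 1 * H 0 + (Σ< (suc m) (λ k → + (m C k) * H (suc k)) + Σ< (suc m) (λ k → + (m C suc k) * H (suc k)))
      ≡⟨ cong (λ z → + 1 * H 0 + z) (trans (sym (Σ<-+ (suc m) (λ k → + (m C k) * H (suc k)) (λ k → + (m C suc k) * H (suc k)))) (Σ<-cong (suc m) step)) ⟩
    + 1 * H 0 + Σ< (suc m) (λ k → + (suc m C suc k) * H (suc k))
      ≡⟨ sym (Σ<-head (suc m) (λ k → + (suc m C k) * H k)) ⟩
    Σ< (suc (suc m)) (λ k → + (suc m C k) * H k) ∎
    where
    swap : ∀ a b c → a + (b + c) ≡ b + (a + c)
    swap = solve-∀
    extend : Σ< (suc m) (λ k → + (m C k) * H k) ≡ + 1 * H 0 + Σ< (suc m) (λ k → + (m C suc k) * H (suc k))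
    extend = begin
      Σ< (suc m) (λ k → + (m C k) * H k)
        ≡⟨ sym (+-identityˡ _) ⟩
      0ℤ + Σ< (suc m) (λ k → + (m C k) * H k)
        ≡⟨ cong (λ z → + z * H (suc m) + Σ< (suc m) (λ k → + (m C k) * H k))
                (sym (k>n⇒nCk≡0 {m} {suc m} ℕ.≤-refl)) ⟩
      Σ< (suc (suc m)) (λ k → + (m C k) * H k)
        ≡⟨ Σ<-head (suc m) (λ k → + (m C k) * H k) ⟩
      + 1 * H 0 + Σ< (suc m) (λ k → + (m C suc k) * H (suc k)) ∎
    step : ∀ k → k ℕ.< suc m → + (m C k) * H (suc k) + + (m C suc k) * H (suc k) ≡ + (suc m C suc k) * H (suc k)
    step k _ = trans (sym (*-distribʳ-+ (H (suc k)) (+ (m C k)) (+ (m C suc k))))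
      (cong (λ z → + z * H (suc k)) (nCk+nC[k+1]≡[n+1]C[k+1] m k))

  pascal-prime : ∀ {q} → Prime q → ∀ H → + q ∣ pascal q H - (H 0 + H q)
  pascal-prime {suc q} pq H = subst (+ suc q ∣_) (sym middle)
    (Σ<-∣ q λ i i<q → ∣m⇒∣m*n {m = + (suc q C suc i)} (H (suc i)) (∣ᵤ⇒∣ (prime∣C pq i (s≤s i<q))))
    where
    cancel : ∀ a b c → b + (a + c) - (a + b) ≡ c
    cancel = solve-∀
    middle : pascal (suc q) H - (H 0 + H (suc q)) ≡ Σ< q (λ k → + (suc q C suc k) * H (suc k))
    middle = begin
      pascal (suc q) H - (H 0 + H (suc q))
        ≡⟨ cong (_- (H 0 + H (suc q))) (pascal-binomial (suc q) H) ⟩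
      + (suc q C suc q) * H (suc q) + Σ< (suc q) (λ k → + (suc q C k) * H k) - (H 0 + H (suc q))
        ≡⟨ cong (_- (H 0 + H (suc q))) (cong₂ _+_ (trans (cong (λ z → + z * H (suc q)) (nCn≡1 (suc q))) (*-identityˡ _))
             (trans (Σ<-head q (λ k → + (suc q C k) * H k)) (cong (_+ Σ< q (λ k → + (suc q C suc k) * H (suc k))) (*-identityˡ (H 0))))) ⟩
      H (suc q) + (H 0 + Σ< q (λ k → + (suc q C suc k) * H (suc k))) - (H 0 + H (suc q))
        ≡⟨ cancel (H 0) (H (suc q)) (Σ< q (λ k → + (suc q C suc k) * H (suc k))) ⟩
      Σ< q (λ k → + (suc q C suc k) * H (suc k)) ∎

  shifts^ : ℕ → List ℤ → (ℤ → ℤ) → ℤ → ℤ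
  shifts^ zero    as f = f
  shifts^ (suc m) as f = shifts^ m as (shifts as f)

  shifts^-cong : ∀ m as {f g} → (∀ x → f x ≡ g x) → ∀ x → shifts^ m as f x ≡ shifts^ m as g x
  shifts^-cong zero    as eq = eq
  shifts^-cong (suc m) as eq = shifts^-cong m as (shifts-cong as eq)

  shifts^-0 : ∀ m as {f} → (∀ x → f x ≡ 0ℤ) → ∀ x → shifts^ m as f x ≡ 0ℤ
  shifts^-0 zero    as eq = eq
  shifts^-0 (suc m) as eq = shifts^-0 m as (shifts-0 as eq)

  shifts^-+ : ∀ m as f g x → shifts^ m as (λ y → f y + g y) x ≡ shifts^ m as f x + shifts^ m as g x
  shifts^-+ zero    as f g x = refl
  shifts^-+ (suc m) as f g x = trans (shifts^-cong m as (shifts-+ as f g) x) (shifts^-+ m as _ _ x)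

  shifts^-translate : ∀ m as f b x → shifts^ m as (λ y → f (y + b)) x ≡ shifts^ m as f (x + b)
  shifts^-translate zero    as f b x = refl
  shifts^-translate (suc m) as f b x =
    trans (shifts^-cong m as (shifts-translate as f b) x) (shifts^-translate m as _ b x)

  shifts^-[] : ∀ m .{{_ : ℕ.NonZero m}} f x → shifts^ m [] f x ≡ 0ℤ
  shifts^-[] (suc m) f = shifts^-0 m [] (λ _ → refl)

  shifts^-∷ : ∀ m a as f x →
    shifts^ m (a ∷ as) f x ≡ pascal m (λ i → shifts^ (m ∸ i) as f (x + + i * a))
  shifts^-∷ zero    a as f x = cong f (sym (trans (cong (λ z → x + z) (*-zeroˡ a)) (+-identityʳ x)))
  shifts^-∷ (suc m) a as f x = begin
    shifts^ m (a ∷ as) (shifts (a ∷ as) f) x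
      ≡⟨ shifts^-∷ m a as (shifts (a ∷ as) f) x ⟩
    pascal m (λ i → shifts^ (m ∸ i) as (shifts (a ∷ as) f) (x + + i * a))
      ≡⟨ pascal-cong m step ⟩
    pascal m (λ i → shifts^ (m ∸ i) as f (x + + suc i * a) + shifts^ (suc m ∸ i) as f (x + + i * a))
      ≡⟨ pascal-+ m _ _ ⟩
    pascal (suc m) (λ i → shifts^ (suc m ∸ i) as f (x + + i * a)) ∎
    where
    next : ∀ x i a → x + i * a + a ≡ x + (+ 1 + i) * a
    next = solve-∀
    step : ∀ i → i ℕ.≤ m → shifts^ (m ∸ i) as (shifts (a ∷ as) f) (x + + i * a) ≡
      shifts^ (m ∸ i) as f (x + + suc i * a) + shifts^ (suc m ∸ i) as f (x + + i * a)
    step i i≤m = trans (shifts^-+ (m ∸ i) as _ _ _) (cong₂ _+_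
      (trans (shifts^-translate (m ∸ i) as f a _) (cong (shifts^ (m ∸ i) as f) (next x (+ i) a)))
      (cong (λ k → shifts^ k as f (x + + i * a)) (sym (ℕ.+-∸-assoc 1 i≤m))))

  dilate : ℤ → List ℤ → List ℤ
  dilate k = map (k *_)

  frobenius : ∀ {q} → Prime q → ∀ as f x → + q ∣ shifts^ q as f x - shifts (dilate (+ q) as) f x
  frobenius {q} pq [] f x = divides 0ℤ (trans (+-identityʳ _) (shifts^-[] q {{prime⇒nonZero pq}} f x))
  frobenius {q} pq (a ∷ as) f x =
    subst (+ q ∣_) (trans (cong₂ (λ u v → P - (u + v) + (u - R)) head last)
        (trans (rearrange P S T R) (cong (_- (T + R)) (sym (shifts^-∷ q a as f x)))))
      (∣m∣n⇒∣m+n (pascal-prime pq H) (subst (λ u → + q ∣ u - R) (sym head) (frobenius pq as f x)))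
    where
    H : ℕ → ℤ
    H i = shifts^ (q ∸ i) as f (x + + i * a)
    P = pascal q H
    S = shifts^ q as f x
    R = shifts (dilate (+ q) as) f x
    T = f (x + + q * a)
    head : H 0 ≡ S
    head = cong (shifts^ q as f) (trans (cong (λ z → x + z) (*-zeroˡ a)) (+-identityʳ x))
    last : H q ≡ T
    last = cong (λ k → shifts^ k as f (x + + q * a)) (ℕ.n∸n≡0 q)
    rearrange : ∀ P S T R → P - (S + T) + (S - R) ≡ P - (T + R)
    rearrange = solve-∀

  Σ<-rotate : ∀ n {f} → Period (+ n) f → Σ< n (λ i → f (+ i + 1ℤ)) ≡ Σ< n (λ i → f (+ i))
  Σ<-rotate n {f} p = +-cancelˡ (f 0ℤ) _ _ (begin
    f 0ℤ + Σ< n (λ i → f (+ i + 1ℤ))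
      ≡⟨ cong (λ z → f 0ℤ + z) (Σ<-cong n (λ i _ → cong (f ∘ +_) (ℕ.+-comm i 1))) ⟩
    f 0ℤ + Σ< n (λ i → f (+ suc i))
      ≡⟨ sym (Σ<-head n (λ i → f (+ i))) ⟩
    f (+ n) + Σ< n (λ i → f (+ i))
      ≡⟨ cong (_+ Σ< n (λ i → f (+ i))) (trans (cong f (sym (+-identityˡ (+ n)))) (p 0ℤ)) ⟩
    f 0ℤ + Σ< n (λ i → f (+ i)) ∎)
    where
    +-cancelˡ : ∀ a b c → a + b ≡ a + c → b ≡ c
    +-cancelˡ a b c eq = trans (sym (lemma a b)) (trans (cong (λ z → - a + z) eq) (lemma a c))
      where
      lemma : ∀ a b → - a + (a + b) ≡ b
      lemma = solve-∀

  period-translate : ∀ {n f} a → Period n f → Period n (λ x → f (x + a))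
  period-translate {n} {f} a p x = trans (cong f (lemma x n a)) (p (x + a))
    where
    lemma : ∀ x n a → x + n + a ≡ x + a + n
    lemma = solve-∀

  Σ<-translate : ∀ n {f} → Period (+ n) f → ∀ a → Σ< n (λ i → f (+ i + a)) ≡ Σ< n (λ i → f (+ i))
  Σ<-translate n {f} p (+ a) = go a
    where
    lemma : ∀ x a → x + (1ℤ + a) ≡ x + 1ℤ + a
    lemma = solve-∀
    go : ∀ a → Σ< n (λ i → f (+ i + + a)) ≡ Σ< n (λ i → f (+ i))
    go zero    = Σ<-cong n (λ i _ → cong f (+-identityʳ (+ i)))
    go (suc a) = trans (Σ<-cong n (λ i _ → cong f (lemma (+ i) (+ a))))
      (trans (Σ<-rotate n (period-translate (+ a) p)) (go a))
  Σ<-translate n {f} p -[1+ a ] = sym (trans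
    (Σ<-cong n (λ i _ → cong f (sym (lemma (+ i) (+ suc a)))))
    (Σ<-translate n (period-translate -[1+ a ] p) (+ suc a)))
    where
    lemma : ∀ x a → x + a + - a ≡ x
    lemma = solve-∀

  shifts-adjoint : ∀ n as {f g} → Period (+ n) f → Period (+ n) g →
    Σ< n (λ i → shifts as f (+ i) * g (+ i)) ≡ Σ< n (λ i → f (+ i) * shifts (map -_ as) g (+ i))
  shifts-adjoint n []       {f} pf pg = Σ<-cong n (λ i _ → sym (*-zeroʳ (f (+ i))))
  shifts-adjoint n (a ∷ as) {f} {g} pf pg = begin
    Σ< n (λ i → (f (+ i + a) + shifts as f (+ i)) * g (+ i))
      ≡⟨ Σ<-cong n (λ i _ → *-distribʳ-+ (g (+ i)) (f (+ i + a)) (shifts as f (+ i))) ⟩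
    Σ< n (λ i → f (+ i + a) * g (+ i) + shifts as f (+ i) * g (+ i))
      ≡⟨ Σ<-+ n (λ i → f (+ i + a) * g (+ i)) (λ i → shifts as f (+ i) * g (+ i)) ⟩
    Σ< n (λ i → f (+ i + a) * g (+ i)) + Σ< n (λ i → shifts as f (+ i) * g (+ i))
      ≡⟨ cong₂ _+_ move (shifts-adjoint n as pf pg) ⟩
    Σ< n (λ i → f (+ i) * g (+ i + - a)) + Σ< n (λ i → f (+ i) * shifts (map -_ as) g (+ i))
      ≡⟨ sym (Σ<-+ n (λ i → f (+ i) * g (+ i + - a)) (λ i → f (+ i) * shifts (map -_ as) g (+ i))) ⟩
    Σ< n (λ i → f (+ i) * g (+ i + - a) + f (+ i) * shifts (map -_ as) g (+ i))
      ≡⟨ Σ<-cong n (λ i _ → sym (*-distribˡ-+ (f (+ i)) (g (+ i + - a)) (shifts (map -_ as) g (+ i)))) ⟩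
    Σ< n (λ i → f (+ i) * shifts (map -_ (a ∷ as)) g (+ i)) ∎
    where
    lemma : ∀ x a → x + a + - a ≡ x
    lemma = solve-∀
    F : ℤ → ℤ
    F x = f x * g (x + - a)
    move : Σ< n (λ i → f (+ i + a) * g (+ i)) ≡ Σ< n (λ i → F (+ i))
    move = trans (Σ<-cong n (λ i _ → cong (λ z → f (+ i + a) * g z) (sym (lemma (+ i) a))))
      (Σ<-translate n (λ x → cong₂ _*_ (pf x) (period-translate (- a) pg x)) a)

  Σ<-nonneg : ∀ n (s : ℕ → ℕ) → ∃[ m ] Σ< n (λ i → + s i) ≡ + m
  Σ<-nonneg zero    s = 0 , refl
  Σ<-nonneg (suc n) s with Σ<-nonneg n s
  ... | m , eq = s n ℕ.+ m , cong (λ z → + s n + z) eq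

  Σ<-nonneg≡0 : ∀ n (s : ℕ → ℕ) → Σ< n (λ i → + s i) ≡ 0ℤ → ∀ i → i ℕ.< n → s i ≡ 0
  Σ<-nonneg≡0 (suc n) s eq i i<1+n with Σ<-nonneg n s
  ... | m , eqm with ℕ.m≤n⇒m<n∨m≡n (ℕ.≤-pred i<1+n)
  ...   | inj₂ refl = ℕ.m+n≡0⇒m≡0 (s i) (+-injective (trans (sym (cong (λ z → + s i + z) eqm)) eq))
  ...   | inj₁ i<n  = Σ<-nonneg≡0 n s (trans eqm (cong +_ (ℕ.m+n≡0⇒n≡0 (s n)
                        (+-injective (trans (sym (cong (λ z → + s n + z) eqm)) eq))))) i i<n

  period-residue : ∀ n .{{_ : ℕ.NonZero n}} {f} → Period (+ n) f → ∀ x → f x ≡ f (+ (x %ℕ n))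
  period-residue n {f} p x = trans (cong f (a≡a%ℕn+[a/ℕn]*n x n)) (period-* {f} (x /ℕ n) p (+ (x %ℕ n)))

  Symmetric : List ℤ → Set
  Symmetric as = ∀ f x → shifts (map -_ as) f x ≡ shifts as f x

  shifts-dilate : ∀ k as f x → shifts (dilate k as) f x ≡ shifts as (λ y → f (x + k * y)) 0ℤ
  shifts-dilate k []       f x = refl
  shifts-dilate k (a ∷ as) f x =
    cong₂ _+_ (cong (λ z → f (x + k * z)) (sym (+-identityˡ a))) (shifts-dilate k as f x)

  dilate-symmetric : ∀ k as → Symmetric as → Symmetric (dilate k as)
  dilate-symmetric k as s f x = begin
    shifts (map -_ (map (k *_) as)) f x
      ≡⟨ cong (λ bs → shifts bs f x) (trans (sym (map-∘ as)) (trans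
           (map-cong (λ a → neg-distribʳ-* k a) as) (map-∘ as))) ⟩
    shifts (dilate k (map -_ as)) f x          ≡⟨ shifts-dilate k (map -_ as) f x ⟩
    shifts (map -_ as) (λ y → f (x + k * y)) 0ℤ ≡⟨ s _ 0ℤ ⟩
    shifts as (λ y → f (x + k * y)) 0ℤ         ≡⟨ sym (shifts-dilate k as f x) ⟩
    shifts (dilate k as) f x ∎

  dilate-dilate : ∀ k l as → dilate k (dilate l as) ≡ dilate (k * l) as
  dilate-dilate k l as = trans (sym (map-∘ as)) (map-cong (λ a → sym (*-assoc k l a)) as)

  shifts²-kernel : ∀ n .{{_ : ℕ.NonZero n}} as {f} → Symmetric as → Period (+ n) f →
    (∀ x → shifts as (shifts as f) x ≡ 0ℤ) → ∀ x → shifts as f x ≡ 0ℤ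
  shifts²-kernel n as {f} s p eq x = trans (period-residue n {S} pS x)
    (∣i∣≡0⇒i≡0 (reduce (ℕ.m*n≡0⇒m≡0∨n≡0 _ (Σ<-nonneg≡0 n (λ i → ∣ S (+ i) ∣ ℕ.* ∣ S (+ i) ∣) norm
      (x %ℕ n) (n%ℕd<d x n)))))
    where
    S : ℤ → ℤ
    S = shifts as f
    pS : Period (+ n) S
    pS = shifts-period as p
    square : ∀ i → + (∣ i ∣ ℕ.* ∣ i ∣) ≡ i * i
    square (+ i)    = pos-* i i
    square -[1+ i ] = refl
    norm : Σ< n (λ i → + (∣ S (+ i) ∣ ℕ.* ∣ S (+ i) ∣)) ≡ 0ℤ
    norm = begin
      Σ< n (λ i → + (∣ S (+ i) ∣ ℕ.* ∣ S (+ i) ∣)) ≡⟨ Σ<-cong n (λ i _ → square (S (+ i))) ⟩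
      Σ< n (λ i → S (+ i) * S (+ i))               ≡⟨ shifts-adjoint n as p pS ⟩
      Σ< n (λ i → f (+ i) * shifts (map -_ as) S (+ i))
        ≡⟨ Σ<-cong n (λ i _ → trans (cong (λ z → f (+ i) * z) (trans (s S (+ i)) (eq (+ i)))) (*-zeroʳ (f (+ i)))) ⟩
      Σ< n (λ _ → 0ℤ)                              ≡⟨ Σ<-0 n (λ _ _ → refl) ⟩
      0ℤ ∎

  kernel-dilate-prime : ∀ n .{{_ : ℕ.NonZero n}} {q} → Prime q → ∀ as → length as ℕ.< q → Symmetric as →
    ∀ B f → Period (+ n) f → (∀ x → ∣ f x ∣ ℕ.≤ B) → (∀ x → shifts as f x ≡ 0ℤ) →
    ∀ x → shifts (dilate (+ q) as) f x ≡ 0ℤ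
  kernel-dilate-prime n {q} pq as len<q s zero    f p fB eq =
    shifts-0 (dilate (+ q) as) (λ x → ∣i∣≡0⇒i≡0 (ℕ.n≤0⇒n≡0 (fB x)))
  kernel-dilate-prime n {q@(suc q-1)} pq as len<q s (suc B) f p fB eq =
    shifts²-kernel n D (dilate-symmetric (+ q) as s) p λ x → begin
      shifts D S x                   ≡⟨ shifts-cong D S≡ x ⟩
      shifts D (λ y → + q * f₁ y) x  ≡⟨ shifts-* D (+ q) f₁ x ⟩
      + q * shifts D f₁ x            ≡⟨ cong (+ q *_) (kernel-dilate-prime n pq as len<q s B f₁ p₁ f₁B eq₁ x) ⟩
      + q * 0ℤ                       ≡⟨ *-zeroʳ (+ q) ⟩
      0ℤ ∎
    where
    D : List ℤ
    D = dilate (+ q) as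
    S : ℤ → ℤ
    S = shifts D f
    q∣S : ∀ x → + q ∣ S x
    q∣S x = subst (+ q ∣_) (neg-involutive (S x)) (∣m⇒∣-m
      (subst (+ q ∣_) (trans (cong (_- S x) (shifts^-0 q-1 as eq x)) (+-identityˡ (- S x)))
        (frobenius pq as f x)))
    f₁ : ℤ → ℤ
    f₁ x = _∣_.quotient (q∣S x)
    S≡ : ∀ x → S x ≡ + q * f₁ x
    S≡ x = trans (_∣_.equality (q∣S x)) (*-comm (f₁ x) (+ q))
    p₁ : Period (+ n) f₁
    p₁ x = *-cancelˡ-≡ (+ q) _ _ (trans (sym (S≡ (x + + n))) (trans (shifts-period D p x) (S≡ x)))
    f₁B : ∀ x → ∣ f₁ x ∣ ℕ.≤ B
    f₁B x = ℕ.≤-pred (ℕ.*-cancelˡ-< q _ _ (ℕ.<-≤-trans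
      (subst (ℕ._< q ℕ.* suc B) (trans (cong ∣_∣ (S≡ x)) (abs-* (+ q) (f₁ x)))
        (ℕ.≤-<-trans (shifts-bound D (suc B) fB x)
          (ℕ.*-monoˡ-< (suc B) (subst (ℕ._< q) (sym (length-map (+ q *_) as)) len<q))))
      ℕ.≤-refl))
    eq₁ : ∀ x → shifts as f₁ x ≡ 0ℤ
    eq₁ x = *-cancelˡ-≡ (+ q) _ _ (begin
      + q * shifts as f₁ x              ≡⟨ sym (shifts-* as (+ q) f₁ x) ⟩
      shifts as (λ y → + q * f₁ y) x    ≡⟨ shifts-cong as (λ y → sym (S≡ y)) x ⟩
      shifts as (shifts D f) x          ≡⟨ shifts-comm as D f x ⟩
      shifts D (shifts as f) x          ≡⟨ shifts-0 D eq x ⟩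
      0ℤ                                ≡⟨ sym (*-zeroʳ (+ q)) ⟩
      + q * 0ℤ ∎)

  7≤prime : ∀ {q} → Prime q → ¬ 2 ℕ.∣ q → ¬ 3 ℕ.∣ q → ¬ 5 ℕ.∣ q → 7 ℕ.≤ q
  7≤prime {0} pq _ _ _ = ⊥-elim (¬prime[0] pq)
  7≤prime {1} pq _ _ _ = ⊥-elim (¬prime[1] pq)
  7≤prime {2} _ 2∤ _ _ = ⊥-elim (2∤ ℕ.∣-refl)
  7≤prime {3} _ _ 3∤ _ = ⊥-elim (3∤ ℕ.∣-refl)
  7≤prime {4} _ 2∤ _ _ = ⊥-elim (2∤ (ℕ.divides 2 refl))
  7≤prime {5} _ _ _ 5∤ = ⊥-elim (5∤ ℕ.∣-refl)
  7≤prime {6} _ 2∤ _ _ = ⊥-elim (2∤ (ℕ.divides 3 refl))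
  7≤prime {suc (suc (suc (suc (suc (suc (suc q))))))} _ _ _ _ = s≤s (s≤s (s≤s (s≤s (s≤s (s≤s (s≤s z≤n))))))

  module _ (n : ℕ) .{{_ : ℕ.NonZero n}} (as : List ℤ) (len : length as ℕ.< 7) (s : Symmetric as)
    (B : ℕ) (f : ℤ → ℤ) (p : Period (+ n) f) (fB : ∀ x → ∣ f x ∣ ℕ.≤ B) (eq : ∀ x → shifts as f x ≡ 0ℤ) where

    kernel-dilate-product : ∀ ps → All Prime ps →
      ¬ 2 ℕ.∣ product ps → ¬ 3 ℕ.∣ product ps → ¬ 5 ℕ.∣ product ps →
      ∀ x → shifts (dilate (+ product ps) as) f x ≡ 0ℤ
    kernel-dilate-product [] [] _ _ _ x =
      trans (cong (λ bs → shifts bs f x) (trans (map-cong *-identityˡ as) (map-id as))) (eq x)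
    kernel-dilate-product (q ∷ ps) (pq ∷ pps) 2∤ 3∤ 5∤ x =
      trans (cong (λ bs → shifts bs f x)
               (trans (cong (λ k → dilate k as) (pos-* q (product ps)))
                      (sym (dilate-dilate (+ q) (+ product ps) as))))
        (kernel-dilate-prime n pq (dilate (+ product ps) as)
          (ℕ.<-≤-trans (subst (ℕ._< 7) (sym (length-map (+ product ps *_) as)) len)
            (7≤prime pq (2∤ ∘ ℕ.∣m⇒∣m*n (product ps)) (3∤ ∘ ℕ.∣m⇒∣m*n (product ps)) (5∤ ∘ ℕ.∣m⇒∣m*n (product ps))))
          (dilate-symmetric (+ product ps) as s) B f p fB
          (kernel-dilate-product ps pps (2∤ ∘ ℕ.∣n⇒∣m*n q) (3∤ ∘ ℕ.∣n⇒∣m*n q) (5∤ ∘ ℕ.∣n⇒∣m*n q)) x)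

    kernel-dilate : ∀ k → ¬ 2 ℕ.∣ k → ¬ 3 ℕ.∣ k → ¬ 5 ℕ.∣ k →
      ∀ x → shifts (dilate (+ k) as) f x ≡ 0ℤ
    kernel-dilate zero      2∤ _  _  = ⊥-elim (2∤ (ℕ.divides 0 refl))
    kernel-dilate k@(suc _) 2∤ 3∤ 5∤ x =
      subst (λ k → shifts (dilate (+ k) as) f x ≡ 0ℤ) (sym isFactorisation)
        (kernel-dilate-product factors factorsPrime
          (subst (¬_ ∘ (2 ℕ.∣_)) isFactorisation 2∤) (subst (¬_ ∘ (3 ℕ.∣_)) isFactorisation 3∤)
          (subst (¬_ ∘ (5 ℕ.∣_)) isFactorisation 5∤) x)
      where open PrimeFactorisation (factorise k)

  prime∤⇒coprime : ∀ {p m} → Prime p → ¬ p ℕ.∣ m → Coprime m p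
  prime∤⇒coprime pp p∤m (d∣m , d∣p) with prime⇒irreducible pp d∣p
  ... | inj₁ d≡1  = d≡1
  ... | inj₂ refl = ⊥-elim (p∤m d∣m)

  Σ<-minus : ∀ n f g → Σ< n (λ i → f i - g i) ≡ Σ< n f - Σ< n g
  Σ<-minus zero    f g = refl
  Σ<-minus (suc n) f g = trans (cong (λ z → f n - g n + z) (Σ<-minus n f g))
    (lemma (f n) (g n) (Σ< n f) (Σ< n g))
    where
    lemma : ∀ a b c d → a - b + (c - d) ≡ a + c - (b + d)
    lemma = solve-∀

  neighbours : ℤ → List ℤ
  neighbours c = 0ℤ ∷ 0ℤ ∷ 1ℤ ∷ - 1ℤ ∷ c ∷ - c ∷ []

  Δ : ℕ → (ℤ → ℤ) → ℤ → ℤ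
  Δ P f x = f (x + + P) - f x

  -- T^P generates the subgroup of order p of ℤ/pP, so progression f b averages
  -- f over that subgroup if p ∤ b, and is p f if p ∣ b.
  module Fibre (p : ℕ) (pp : Prime p) (P w : ℕ) (p∤w : ¬ p ℕ.∣ w)
               (f : ℤ → ℤ) (pf : Period (+ (p ℕ.* P)) f) where

    W : ℤ
    W = + (w ℕ.* P)

    progression : (ℤ → ℤ) → ℤ → ℤ → ℤ
    progression f b x = Σ< p (λ i → f (x + + i * (W * b)))

    private
      instance p≢0 : ℕ.NonZero p
      p≢0 = prime⇒nonZero pp

    period-pW : ∀ {f} → Period (+ (p ℕ.* P)) f → ∀ k → Period (k * + p * W) f
    period-pW {f} pf k = subst (λ a → Period a f) eq (period-* {f} (k * + w) pf)
      where
      lemma : ∀ k w p P → k * w * (p * P) ≡ k * p * (w * P)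
      lemma = solve-∀
      eq : k * + w * + (p ℕ.* P) ≡ k * + p * W
      eq = trans (cong (k * + w *_) (pos-* p P)) (trans (lemma k (+ w) (+ p) (+ P))
             (cong (k * + p *_) (sym (pos-* w P))))

    progression-period-W : ∀ b → Period (W * b) (progression f b)
    progression-period-W b x = trans (Σ<-cong p (λ i _ → cong f (next x (W * b) (+ i))))
      (Σ<-rotate p {λ z → f (x + z * (W * b))} λ z →
        trans (cong f (wrap x z (+ p) W b)) (period-pW pf b (x + z * (W * b))))
      where
      next : ∀ x a i → x + a + i * a ≡ x + (i + 1ℤ) * a
      next = solve-∀
      wrap : ∀ x z p W b → x + (z + p) * (W * b) ≡ x + z * (W * b) + b * p * W
      wrap = solve-∀

    progression-period-n : ∀ b → Period (+ (p ℕ.* P)) (progression f b)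
    progression-period-n b x = Σ<-cong p (λ i _ → period-translate (+ i * (W * b)) pf x)

    progression-period : ∀ b → ¬ + p ∣ b → Period (+ P) (progression f b)
    progression-period b p∤b = subst (λ d → Period (+ d) (progression f b)) gcd≡P
      (period-gcd {progression f b} (period-∣a∣ (W * b) (progression-period-W b)) (progression-period-n b))
      where
      p∤wb : ¬ p ℕ.∣ w ℕ.* ∣ b ∣
      p∤wb p∣wb with euclidsLemma w ∣ b ∣ pp p∣wb
      ... | inj₁ p∣w = p∤w p∣w
      ... | inj₂ p∣b = p∤b (∣ᵤ⇒∣ p∣b)
      gcd≡P : gcd ∣ W * b ∣ (p ℕ.* P) ≡ P
      gcd≡P = trans (cong₂ gcd
          (trans (abs-* W b) (trans (cong (ℕ._* ∣ b ∣) (ℕ.*-comm w P)) (ℕ.*-assoc P w ∣ b ∣))) (ℕ.*-comm p P))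
        (trans (sym (c*gcd[m,n]≡gcd[cm,cn] P (w ℕ.* ∣ b ∣) p))
          (trans (cong (P ℕ.*_) (coprime⇒gcd≡1 (prime∤⇒coprime pp p∤wb))) (ℕ.*-identityʳ P)))

    g : ℤ → ℤ
    g = Δ P f

    g-period : Period (+ (p ℕ.* P)) g
    g-period x = cong₂ _-_ (period-translate (+ P) pf x) (pf x)

    progression-unit : ∀ b → ¬ + p ∣ b → ∀ x → progression g b x ≡ 0ℤ
    progression-unit b p∤b x = trans (Σ<-minus p (λ i → f (x + + i * (W * b) + + P)) (λ i → f (x + + i * (W * b))))
      (trans (cong (_- progression f b x)
        (trans (Σ<-cong p (λ i _ → cong f (swap x (+ i * (W * b)) (+ P)))) (progression-period b p∤b x)))
        (+-inverseʳ (progression f b x)))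
      where
      swap : ∀ x a P → x + a + P ≡ x + P + a
      swap = solve-∀

    progression-null : ∀ b → + p ∣ b → ∀ x → progression g b x ≡ + p * g x
    progression-null b (divides k refl) x =
      trans (Σ<-cong p (λ i _ → trans (cong g (lemma x (+ i) W k (+ p))) (period-pW g-period (+ i * k) x)))
        (Σ<-const p (g x))
      where
      lemma : ∀ x i W k p → x + i * (W * (k * p)) ≡ x + i * k * p * W
      lemma = solve-∀
      Σ<-const : ∀ m a → Σ< m (λ _ → a) ≡ + m * a
      Σ<-const zero    a = sym (*-zeroˡ a)
      Σ<-const (suc m) a = trans (cong (λ z → a + z) (Σ<-const m a)) (sym (suc-* (+ m) a))

    conjugate : List ℤ → ℕ → ℤ → ℤ
    conjugate as i = shifts (dilate (1ℤ + + i * W) as) g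

    isotypic : List ℤ → ℤ → ℤ → ℤ
    isotypic []       s x = 0ℤ
    isotypic (a ∷ as) s x = progression g (a - s) (x + a) + isotypic as s x

    Σ-conjugates : ∀ as s x → Σ< p (λ i → conjugate as i (x - + i * (W * s))) ≡ isotypic as s x
    Σ-conjugates []       s x = Σ<-0 p (λ _ _ → refl)
    Σ-conjugates (a ∷ as) s x = trans
      (Σ<-+ p (λ i → g (x - + i * (W * s) + (1ℤ + + i * W) * a)) (λ i → conjugate as i (x - + i * (W * s))))
      (cong₂ _+_ (Σ<-cong p (λ i _ → cong g (lemma x (+ i) W s a))) (Σ-conjugates as s x))
      where
      lemma : ∀ x i W s a → x - i * (W * s) + (1ℤ + i * W) * a ≡ x + a + i * (W * (a - s))
      lemma = solve-∀

    cancel-p : ∀ k .{{_ : ℕ.NonZero k}} x → + k * (+ p * g x) ≡ 0ℤ → g x ≡ 0ℤ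
    cancel-p k x eq = *-cancelˡ-≡ (+ p) _ _ (trans (*-cancelˡ-≡ (+ k) _ _ (trans eq (sym (*-zeroʳ (+ k)))))
      (sym (*-zeroʳ (+ p))))

    module _ (c : ℤ) where

      isotypic-0 : ¬ + p ∣ 1ℤ → ¬ + p ∣ c → ∀ x → isotypic (neighbours c) 0ℤ x ≡ + 2 * (+ p * g x)
      isotypic-0 p∤1 p∤c x = trans
        (cong₂ _+_ null (cong₂ _+_ null (cong₂ _+_ (progression-unit 1ℤ p∤1 (x + 1ℤ))
          (cong₂ _+_ (progression-unit (- 1ℤ) (p∤1 ∘ ∣m⇒∣-m) (x + - 1ℤ)) (cong₂ _+_
          (progression-unit (c - 0ℤ) (p∤c ∘ subst (+ p ∣_) (+-identityʳ c)) (x + c))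
          (cong₂ _+_ (progression-unit (- c - 0ℤ) (p∤c ∘ lemma) (x + - c)) refl))))))
        (double (+ p * g x))
        where
        lemma : + p ∣ - c - 0ℤ → + p ∣ c
        lemma p∣ = subst (+ p ∣_) (trans (cong -_ (+-identityʳ (- c))) (neg-involutive c)) (∣m⇒∣-m p∣)
        null : progression g 0ℤ (x + 0ℤ) ≡ + p * g x
        null = trans (progression-null 0ℤ (divides 0ℤ refl) (x + 0ℤ)) (cong (λ z → + p * g z) (+-identityʳ x))
        double : ∀ y → y + (y + 0ℤ) ≡ + 2 * y
        double = solve-∀

      isotypic-1 : ¬ + p ∣ 1ℤ → ¬ + p ∣ + 2 → ¬ + p ∣ c - 1ℤ → ¬ + p ∣ c + 1ℤ →
                   ∀ x → isotypic (neighbours c) 1ℤ x ≡ + p * g (x + 1ℤ)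
      isotypic-1 p∤1 p∤2 p∤c-1 p∤c+1 x = trans
        (cong₂ _+_ unit₀ (cong₂ _+_ unit₀ (cong₂ _+_ (progression-null 0ℤ (divides 0ℤ refl) (x + 1ℤ))
          (cong₂ _+_ (progression-unit (- + 2) (p∤2 ∘ ∣m⇒∣-m) (x + - 1ℤ)) (cong₂ _+_
          (progression-unit (c - 1ℤ) p∤c-1 (x + c))
          (cong₂ _+_ (progression-unit (- c - 1ℤ) (p∤c+1 ∘ lemma) (x + - c)) refl))))))
        (single (+ p * g (x + 1ℤ)))
        where
        unit₀ : progression g (- 1ℤ) (x + 0ℤ) ≡ 0ℤ
        unit₀ = progression-unit (- 1ℤ) (p∤1 ∘ ∣m⇒∣-m) (x + 0ℤ)
        flip : ∀ c → - (- c - 1ℤ) ≡ c + 1ℤ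
        flip = solve-∀
        lemma : + p ∣ - c - 1ℤ → + p ∣ c + 1ℤ
        lemma p∣ = subst (+ p ∣_) (flip c) (∣m⇒∣-m p∣)
        single : ∀ y → 0ℤ + (0ℤ + (y + 0ℤ)) ≡ y
        single = solve-∀

      conjugates-0⇒g≡0 : ¬ + p ∣ + 2 →
        (∀ i → i ℕ.< p → ∀ x → conjugate (neighbours c) i x ≡ 0ℤ) → ∀ x → g x ≡ 0ℤ
      conjugates-0⇒g≡0 p∤2 eq x = split (+ p ∣? c)
        where
        p∤1 : ¬ + p ∣ 1ℤ
        p∤1 = p∤2 ∘ ∣n⇒∣m*n (+ 2) {1ℤ}
        isotypic≡0 : ∀ s x → isotypic (neighbours c) s x ≡ 0ℤ
        isotypic≡0 s x = trans (sym (Σ-conjugates (neighbours c) s x))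
          (Σ<-0 p (λ i i<p → eq i i<p (x - + i * (W * s))))
        lemma : ∀ x → x - 1ℤ + 1ℤ ≡ x
        lemma = solve-∀
        split : Dec (+ p ∣ c) → g x ≡ 0ℤ
        split (no  p∤c) = cancel-p 2 x (trans (sym (isotypic-0 p∤1 p∤c x)) (isotypic≡0 0ℤ x))
        split (yes p∣c) = trans (cong g (sym (lemma x)))
          (cancel-p 1 (x - 1ℤ + 1ℤ) (trans (*-identityˡ (+ p * g (x - 1ℤ + 1ℤ)))
            (trans (sym (isotypic-1 p∤1 p∤2 (p∤1 ∘ below) (p∤1 ∘ above) (x - 1ℤ))) (isotypic≡0 1ℤ (x - 1ℤ)))))
          where
          above : + p ∣ c + 1ℤ → + p ∣ 1ℤ
          above p∣ = ∣m+n∣m⇒∣n p∣ p∣c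
          below : + p ∣ c - 1ℤ → + p ∣ 1ℤ
          below p∣ = subst (+ p ∣_) (neg-involutive 1ℤ) (∣m⇒∣-m (∣m+n∣m⇒∣n {m = c} p∣ p∣c))

  doubling⇒0 : ∀ n .{{_ : ℕ.NonZero n}} {g} δ → Period (+ n) g → (∀ x → g (x + δ) ≡ + 2 * g x) → ∀ x → g x ≡ 0ℤ
  doubling⇒0 n {g} δ pg dbl x with ∣ g x ∣ in eq
  ... | zero  = ∣i∣≡0⇒i≡0 eq
  ... | suc m = ⊥-elim (ℕ.<⇒≢ (ℕ.^-monoʳ-< 2 (s≤s (s≤s z≤n)) (ℕ.>-nonZero⁻¹ n)) (ℕ.*-cancelʳ-≡ 1 (2 ℕ.^ n) (suc m) (begin
      1 ℕ.* suc m            ≡⟨ ℕ.*-identityˡ (suc m) ⟩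
      suc m                  ≡⟨ sym eq ⟩
      ∣ g x ∣                ≡⟨ cong ∣_∣ (sym (period-* {g} δ pg x)) ⟩
      ∣ g (x + δ * + n) ∣    ≡⟨ cong (∣_∣ ∘ g ∘ (λ z → x + z)) (*-comm δ (+ n)) ⟩
      ∣ g (x + + n * δ) ∣    ≡⟨ grow n ⟩
      2 ℕ.^ n ℕ.* ∣ g x ∣    ≡⟨ cong (2 ℕ.^ n ℕ.*_) eq ⟩
      2 ℕ.^ n ℕ.* suc m      ∎)))
    where
    next : ∀ x i δ → x + (1ℤ + i) * δ ≡ x + i * δ + δ
    next = solve-∀
    grow : ∀ k → ∣ g (x + + k * δ) ∣ ≡ 2 ℕ.^ k ℕ.* ∣ g x ∣
    grow zero    = trans (cong (∣_∣ ∘ g) (trans (cong (λ z → x + z) (*-zeroˡ δ)) (+-identityʳ x))) (sym (ℕ.*-identityˡ ∣ g x ∣))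
    grow (suc k) = begin
      ∣ g (x + + suc k * δ) ∣      ≡⟨ cong (∣_∣ ∘ g) (next x (+ k) δ) ⟩
      ∣ g (x + + k * δ + δ) ∣      ≡⟨ cong ∣_∣ (dbl (x + + k * δ)) ⟩
      ∣ + 2 * g (x + + k * δ) ∣    ≡⟨ abs-* (+ 2) (g (x + + k * δ)) ⟩
      2 ℕ.* ∣ g (x + + k * δ) ∣    ≡⟨ cong (2 ℕ.*_) (grow k) ⟩
      2 ℕ.* (2 ℕ.^ k ℕ.* ∣ g x ∣)  ≡⟨ sym (ℕ.*-assoc 2 (2 ℕ.^ k) ∣ g x ∣) ⟩
      2 ℕ.^ suc k ℕ.* ∣ g x ∣      ∎

  -- For p = 5 with 25 ∤ n, W ≡ 1 modulo 5 and 5 ∣ 1 + 4W, so the relation for i = 4 is not available.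
  module Fibre₅ (p5 : Prime 5) (P w : ℕ) .{{_ : ℕ.NonZero P}} (5∤w : ¬ 5 ℕ.∣ w)
                (f : ℤ → ℤ) (pf : Period (+ (5 ℕ.* P)) f) (c : ℤ)
                (5∤c-1 : ¬ + 5 ∣ c - 1ℤ) (5∤c+1 : ¬ + 5 ∣ c + 1ℤ) where

    open Fibre 5 p5 P w 5∤w f pf

    as : List ℤ
    as = neighbours c

    module _ (eq : ∀ i → i ℕ.< 4 → ∀ x → conjugate as i x ≡ 0ℤ) where

      last-conjugate : ∀ s x → conjugate as 4 (x - + 4 * (W * s)) ≡ isotypic as s x
      last-conjugate s x = trans (sym (trans
        (cong (λ z → conjugate as 4 (x - + 4 * (W * s)) + z) (Σ<-0 4 (λ i i<4 → eq i i<4 (x - + i * (W * s)))))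
        (+-identityʳ (conjugate as 4 (x - + 4 * (W * s)))))) (Σ-conjugates as s x)

      isotypic-2 : + 5 ∣ c → ∀ x → isotypic as (+ 2) x ≡ 0ℤ
      isotypic-2 5∣c x = cong₂ _+_ unit₀ (cong₂ _+_ unit₀ (cong₂ _+_
        (progression-unit (- 1ℤ) (from-no (+ 5 ∣? - 1ℤ)) (x + 1ℤ)) (cong₂ _+_
        (progression-unit (- + 3) (from-no (+ 5 ∣? - + 3)) (x + - 1ℤ)) (cong₂ _+_
        (progression-unit (c - + 2) (λ 5∣ → from-no (+ 5 ∣? - + 2) (∣m+n∣m⇒∣n 5∣ 5∣c)) (x + c)) (cong₂ _+_
        (progression-unit (- c - + 2) (λ 5∣ → from-no (+ 5 ∣? - + 2) (∣m+n∣m⇒∣n 5∣ (∣m⇒∣-m 5∣c))) (x + - c))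
        refl)))))
        where
        unit₀ : progression g (- + 2) (x + 0ℤ) ≡ 0ℤ
        unit₀ = progression-unit (- + 2) (from-no (+ 5 ∣? - + 2)) (x + 0ℤ)

      g≡0 : ∀ x → g x ≡ 0ℤ
      g≡0 x with + 5 ∣? c
      ... | yes 5∣c = conjugates-0⇒g≡0 c (from-no (+ 5 ∣? + 2)) all x
        where
        back : ∀ x a → x + a - a ≡ x
        back = solve-∀
        all : ∀ i → i ℕ.< 5 → ∀ x → conjugate as i x ≡ 0ℤ
        all i i<5 x with ℕ.m≤n⇒m<n∨m≡n (ℕ.≤-pred i<5)
        ... | inj₁ i<4  = eq i i<4 x
        ... | inj₂ refl = trans (cong (conjugate as 4) (sym (back x (+ 4 * (W * + 2)))))
          (trans (last-conjugate (+ 2) (x + + 4 * (W * + 2))) (isotypic-2 5∣c (x + + 4 * (W * + 2))))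
      ... | no 5∤c = doubling⇒0 (5 ℕ.* P) {{ℕ.m*n≢0 5 P}} (1ℤ + + 4 * W) g-period double x
        where
        at0 : ∀ x → conjugate as 4 x ≡ + 2 * (+ 5 * g x)
        at0 x = trans (cong (conjugate as 4) (sym (lemma x W)))
          (trans (last-conjugate 0ℤ x) (isotypic-0 c (from-no (+ 5 ∣? 1ℤ)) 5∤c x))
          where
          lemma : ∀ x W → x - + 4 * (W * 0ℤ) ≡ x
          lemma = solve-∀
        at1 : ∀ x → conjugate as 4 (x - + 4 * (W * 1ℤ)) ≡ + 5 * g (x + 1ℤ)
        at1 x = trans (last-conjugate 1ℤ x)
          (isotypic-1 c (from-no (+ 5 ∣? 1ℤ)) (from-no (+ 5 ∣? + 2)) 5∤c-1 5∤c+1 x)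
        double : ∀ x → g (x + (1ℤ + + 4 * W)) ≡ + 2 * g x
        double x = *-cancelˡ-≡ (+ 5) _ _ (begin
          + 5 * g (x + (1ℤ + + 4 * W))         ≡⟨ cong (λ z → + 5 * g z) (l₁ x W) ⟩
          + 5 * g (x + + 4 * W + 1ℤ)           ≡⟨ sym (at1 (x + + 4 * W)) ⟩
          conjugate as 4 (x + + 4 * W - + 4 * (W * 1ℤ)) ≡⟨ cong (conjugate as 4) (l₂ x W) ⟩
          conjugate as 4 x                     ≡⟨ at0 x ⟩
          + 2 * (+ 5 * g x)                    ≡⟨ l₃ (g x) ⟩
          + 5 * (+ 2 * g x)                    ∎)
          where
          l₁ : ∀ x W → x + (1ℤ + + 4 * W) ≡ x + + 4 * W + 1ℤ
          l₁ = solve-∀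
          l₂ : ∀ x W → x + + 4 * W - + 4 * (W * 1ℤ) ≡ x
          l₂ = solve-∀
          l₃ : ∀ y → + 2 * (+ 5 * y) ≡ + 5 * (+ 2 * y)
          l₃ = solve-∀

  neighbours-symmetric : ∀ c → Symmetric (neighbours c)
  neighbours-symmetric c f x = trans
    (cong (λ z → f (x + 0ℤ) + (f (x + 0ℤ) + (f (x + - 1ℤ) + (f (x + 1ℤ) + (f (x + - c) + (f z + 0ℤ))))))
      (cong (λ z → x + z) (neg-involutive c)))
    (lemma (f (x + 0ℤ)) (f (x + 1ℤ)) (f (x + - 1ℤ)) (f (x + c)) (f (x + - c)))
    where
    lemma : ∀ o a a' b b' → o + (o + (a' + (a + (b' + (b + 0ℤ))))) ≡ o + (o + (a + (a' + (b + (b' + 0ℤ)))))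
    lemma = solve-∀

  ∤1+ : ∀ {d m} → 2 ℕ.≤ d → d ℕ.∣ m → ¬ d ℕ.∣ 1 ℕ.+ m
  ∤1+ {d} {m} 2≤d d∣m d∣1+m =
    ℕ.<⇒≱ 2≤d (ℕ.∣⇒≤ (ℕ.∣m+n∣m⇒∣n (subst (d ℕ.∣_) (ℕ.+-comm 1 m) d∣1+m) d∣m))

  inverse-mod-5 : ∀ P → ¬ 5 ℕ.∣ P → ∃[ w ] ∃[ m ] (¬ 5 ℕ.∣ w × w ℕ.* P ≡ 1 ℕ.+ 5 ℕ.* m)
  inverse-mod-5 P 5∤P with P ℕ.% 5 in eq | P ℕ./ 5 | ℕ.m≡m%n+[m/n]*n P 5 | ℕ.m%n<n P 5
  ... | 0 | q | _    | _ = ⊥-elim (5∤P (ℕ.m%n≡0⇒n∣m P 5 eq))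
  ... | 1 | q | P≡ | _ = 1 , q , from-no (5 ℕ.∣? 1) , trans (cong (1 ℕ.*_) P≡) (lemma q)
    where
    lemma : ∀ q → 1 ℕ.* (1 ℕ.+ q ℕ.* 5) ≡ 1 ℕ.+ 5 ℕ.* q
    lemma = ℕ.solve-∀
  ... | 2 | q | P≡ | _ = 3 , 1 ℕ.+ 3 ℕ.* q , from-no (5 ℕ.∣? 3) , trans (cong (3 ℕ.*_) P≡) (lemma q)
    where
    lemma : ∀ q → 3 ℕ.* (2 ℕ.+ q ℕ.* 5) ≡ 1 ℕ.+ 5 ℕ.* (1 ℕ.+ 3 ℕ.* q)
    lemma = ℕ.solve-∀
  ... | 3 | q | P≡ | _ = 2 , 1 ℕ.+ 2 ℕ.* q , from-no (5 ℕ.∣? 2) , trans (cong (2 ℕ.*_) P≡) (lemma q)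
    where
    lemma : ∀ q → 2 ℕ.* (3 ℕ.+ q ℕ.* 5) ≡ 1 ℕ.+ 5 ℕ.* (1 ℕ.+ 2 ℕ.* q)
    lemma = ℕ.solve-∀
  ... | 4 | q | P≡ | _ = 4 , 3 ℕ.+ 4 ℕ.* q , from-no (5 ℕ.∣? 4) , trans (cong (4 ℕ.*_) P≡) (lemma q)
    where
    lemma : ∀ q → 4 ℕ.* (4 ℕ.+ q ℕ.* 5) ≡ 1 ℕ.+ 5 ℕ.* (3 ℕ.+ 4 ℕ.* q)
    lemma = ℕ.solve-∀
  ... | suc (suc (suc (suc (suc _)))) | q | _ | s≤s (s≤s (s≤s (s≤s (s≤s ()))))

  module _ (p : ℕ) (pp : Prime p) (2∤p : ¬ 2 ℕ.∣ p) (P : ℕ) .{{_ : ℕ.NonZero P}}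
           (2∣P : 2 ℕ.∣ P) (3∣P : 3 ℕ.∣ P) (c : ℤ) where

    p∤2 : ¬ + p ∣ + 2
    p∤2 p∣2 with prime⇒irreducible (from-yes (prime? 2)) (∣⇒∣ᵤ p∣2)
    ... | inj₁ refl = ¬prime[1] pp
    ... | inj₂ refl = 2∤p ℕ.∣-refl

    private instance
      p≢0 : ℕ.NonZero p
      p≢0 = prime⇒nonZero pp
      pP≢0 : ℕ.NonZero (p ℕ.* P)
      pP≢0 = ℕ.m*n≢0 p P

    module _ {f : ℤ → ℤ} (pf : Period (+ (p ℕ.* P)) f) (B : ℕ) (fB : ∀ x → ∣ f x ∣ ℕ.≤ B)
             (r : ℤ) (eq : ∀ x → shifts (neighbours c) f x ≡ r) where

      Δ-kernel : ∀ x → shifts (neighbours c) (Δ P f) x ≡ 0ℤ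
      Δ-kernel x = begin
        shifts as (λ y → f (y + + P) - f y) x
          ≡⟨ shifts-+ as (λ y → f (y + + P)) (λ y → - f y) x ⟩
        shifts as (λ y → f (y + + P)) x + shifts as (λ y → - f y) x
          ≡⟨ cong₂ _+_ (trans (shifts-translate as f (+ P) x) (eq (x + + P)))
               (trans (shifts-cong as (λ y → sym (-1*i≡-i (f y))) x) (trans (shifts-* as -1ℤ f x)
                 (trans (cong (-1ℤ *_) (eq x)) (-1*i≡-i r)))) ⟩
        r - r ≡⟨ +-inverseʳ r ⟩
        0ℤ ∎
        where
        as : List ℤ
        as = neighbours c

      ΔB : ∀ x → ∣ Δ P f x ∣ ℕ.≤ B ℕ.+ B
      ΔB x = ℕ.≤-trans (∣i-j∣≤∣i∣+∣j∣ (f (x + + P)) (f x)) (ℕ.+-mono-≤ (fB (x + + P)) (fB x))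

      conjugate-0 : ∀ w (p∤w : ¬ p ℕ.∣ w) i → ¬ 5 ℕ.∣ 1 ℕ.+ i ℕ.* (w ℕ.* P) →
        ∀ x → Fibre.conjugate p pp P w p∤w f pf (neighbours c) i x ≡ 0ℤ
      conjugate-0 w p∤w i 5∤k x =
        trans (cong (λ k → shifts (dilate (1ℤ + k) (neighbours c)) (Δ P f) x) (sym (pos-* i (w ℕ.* P))))
        (kernel-dilate (p ℕ.* P) (neighbours c) ℕ.≤-refl (neighbours-symmetric c) (B ℕ.+ B) (Δ P f)
          (Fibre.g-period p pp P w p∤w f pf) ΔB Δ-kernel (1 ℕ.+ i ℕ.* (w ℕ.* P))
          (∤1+ ℕ.≤-refl (ℕ.∣n⇒∣m*n i (ℕ.∣n⇒∣m*n w 2∣P)))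
          (∤1+ (s≤s (s≤s z≤n)) (ℕ.∣n⇒∣m*n i (ℕ.∣n⇒∣m*n w 3∣P)))
          5∤k x)

      Δ≡0 : (p ≡ 5 → ¬ 5 ℕ.∣ P → (¬ + 5 ∣ c - 1ℤ) × (¬ + 5 ∣ c + 1ℤ)) → ∀ x → Δ P f x ≡ 0ℤ
      Δ≡0 5∤c²-1 with p ℕ.≟ 5
      ... | no p≢5 = Fibre.conjugates-0⇒g≡0 p pp P 5 p∤5 f pf c p∤2
            (λ i _ → conjugate-0 5 p∤5 i (∤1+ (s≤s (s≤s z≤n)) (ℕ.∣n⇒∣m*n i (ℕ.m∣m*n P))))
        where
        p∤5 : ¬ p ℕ.∣ 5
        p∤5 p∣5 with prime⇒irreducible (from-yes (prime? 5)) p∣5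
        ... | inj₁ refl = ¬prime[1] pp
        ... | inj₂ p≡5  = p≢5 p≡5
      ... | yes refl with 5 ℕ.∣? P
      ...   | yes 5∣P = Fibre.conjugates-0⇒g≡0 5 pp P 1 5∤1 f pf c p∤2
              (λ i _ → conjugate-0 1 5∤1 i (∤1+ (s≤s (s≤s z≤n)) (ℕ.∣n⇒∣m*n i (ℕ.∣n⇒∣m*n 1 5∣P))))
        where
        5∤1 : ¬ 5 ℕ.∣ 1
        5∤1 = from-no (5 ℕ.∣? 1)
      ...   | no  5∤P with inverse-mod-5 P 5∤P | 5∤c²-1 refl 5∤P
      ...     | w , m , 5∤w , wP≡ | 5∤c-1 , 5∤c+1 = Fibre₅.g≡0 pp P w 5∤w f pf c 5∤c-1 5∤c+1
                (λ i i<4 → conjugate-0 w 5∤w i (5∤k i i<4))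
        where
        lemma : ∀ i m → 1 ℕ.+ i ℕ.* (1 ℕ.+ 5 ℕ.* m) ≡ 5 ℕ.* (i ℕ.* m) ℕ.+ (1 ℕ.+ i)
        lemma = ℕ.solve-∀
        5∤k : ∀ i → i ℕ.< 4 → ¬ 5 ℕ.∣ 1 ℕ.+ i ℕ.* (w ℕ.* P)
        5∤k i i<4 5∣ = ℕ.<⇒≱ (s≤s i<4) (ℕ.∣⇒≤ (ℕ.∣m+n∣m⇒∣n
          (subst (5 ℕ.∣_) (trans (cong (λ z → 1 ℕ.+ i ℕ.* z) wP≡) (lemma i m)) 5∣) (ℕ.m∣m*n (i ℕ.* m))))

  antiperiod⇒period : ∀ {f a} → (∀ x → f (x + a) + f x ≡ 0ℤ) → Period (+ 2 * a) f
  antiperiod⇒period {f} {a} anti x = begin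
    f (x + + 2 * a)               ≡⟨ cong f (l₁ x a) ⟩
    f (x + a + a)                 ≡⟨ l₂ (f (x + a + a)) (f (x + a)) (f x) ⟩
    f (x + a + a) + f (x + a) - (f (x + a) + f x) + f x
      ≡⟨ cong₂ (λ u v → u - v + f x) (anti (x + a)) (anti x) ⟩
    0ℤ - 0ℤ + f x                 ≡⟨ +-identityˡ (f x) ⟩
    f x ∎
    where
    l₁ : ∀ x a → x + + 2 * a ≡ x + a + a
    l₁ = solve-∀
    l₂ : ∀ u v w → u ≡ u + v - (v + w) + w
    l₂ = solve-∀

  Δ-period⇒Δ≡0 : ∀ p .{{_ : ℕ.NonZero p}} P {f} → Period (+ (p ℕ.* P)) f → Period (+ P) (Δ P f) →
                 ∀ x → Δ P f x ≡ 0ℤ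
  Δ-period⇒Δ≡0 p P {f} pf pΔ x = *-cancelˡ-≡ (+ p) _ _ (begin
    + p * Δ P f x                       ≡⟨ l₁ (f x) (+ p * Δ P f x) ⟩
    f x + + p * Δ P f x - f x           ≡⟨ cong (_- f x) (sym (affine p)) ⟩
    f (x + + p * + P) - f x             ≡⟨ cong (λ z → f (x + z) - f x) (sym (pos-* p P)) ⟩
    f (x + + (p ℕ.* P)) - f x           ≡⟨ cong (_- f x) (pf x) ⟩
    f x - f x                           ≡⟨ +-inverseʳ (f x) ⟩
    0ℤ                                  ≡⟨ sym (*-zeroʳ (+ p)) ⟩
    + p * 0ℤ ∎)
    where
    l₁ : ∀ a b → b ≡ a + b - a
    l₁ = solve-∀
    l₂ : ∀ x k P → x + (1ℤ + k) * P ≡ x + k * P + P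
    l₂ = solve-∀
    l₃ : ∀ u v → u ≡ v + (u - v)
    l₃ = solve-∀
    l₄ : ∀ u k d → u + k * d + d ≡ u + (1ℤ + k) * d
    l₄ = solve-∀
    affine : ∀ k → f (x + + k * + P) ≡ f x + + k * Δ P f x
    affine zero    = trans (cong f (trans (cong (λ z → x + z) (*-zeroˡ (+ P))) (+-identityʳ x)))
      (sym (trans (cong (λ z → f x + z) (*-zeroˡ (Δ P f x))) (+-identityʳ (f x))))
    affine (suc k) = begin
      f (x + + suc k * + P)                            ≡⟨ cong f (l₂ x (+ k) (+ P)) ⟩
      f (x + + k * + P + + P)                          ≡⟨ l₃ (f (x + + k * + P + + P)) (f (x + + k * + P)) ⟩
      f (x + + k * + P) + Δ P f (x + + k * + P)        ≡⟨ cong₂ _+_ (affine k) (period-ℕ* k pΔ x) ⟩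
      f x + + k * Δ P f x + Δ P f x                    ≡⟨ l₄ (f x) (+ k) (Δ P f x) ⟩
      f x + + suc k * Δ P f x ∎

  module _ (p : ℕ) .{{_ : ℕ.NonZero p}} (P : ℕ) (c : ℤ)
           (period-c-1 : ∀ {u} → Period (+ (p ℕ.* P)) u → Period (+ 2 * (c - 1ℤ)) u → Period (+ P) u)
           (period-c+1 : ∀ {u} → Period (+ (p ℕ.* P)) u → Period (+ 2 * (c + 1ℤ)) u → Period (+ P) u) where

    -- T + T⁻¹ + T^c + T^(-c) = T^(-c) (1 + T^(c-1)) (1 + T^(c+1))
    odd-Δ≡0 : ∀ {f} → Period (+ (p ℕ.* P)) f →
      (∀ x → f (x + 1ℤ) + f (x - 1ℤ) + f (x + c) + f (x - c) ≡ 0ℤ) → ∀ x → Δ P f x ≡ 0ℤ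
    odd-Δ≡0 {f} pf eq = Δ-period⇒Δ≡0 p P pf
      (period-c+1 (λ x → cong₂ _-_ (period-translate (+ P) pf x) (pf x)) (antiperiod⇒period {Δ P f} anti-Δ))
      where
      A : ℤ → ℤ
      A x = f (x + (c + 1ℤ)) + f x
      a₁ : ∀ x c → x + c + 1ℤ ≡ x + (c + 1ℤ)
      a₁ = solve-∀
      a₂ : ∀ x c → x + c - 1ℤ ≡ x + (c - 1ℤ)
      a₂ = solve-∀
      a₃ : ∀ x c → x + c + c ≡ x + (c - 1ℤ) + (c + 1ℤ)
      a₃ = solve-∀
      a₄ : ∀ x c → x + c - c ≡ x
      a₄ = solve-∀
      reorder : ∀ u v w z → w + v + (u + z) ≡ u + v + w + z
      reorder = solve-∀
      anti-A : ∀ x → A (x + (c - 1ℤ)) + A x ≡ 0ℤ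
      anti-A x = trans (reorder (f (x + (c + 1ℤ))) (f (x + (c - 1ℤ))) (f (x + (c - 1ℤ) + (c + 1ℤ))) (f x))
        (trans (cong₂ _+_ (cong₂ _+_ (cong₂ (λ u v → f u + f v) (sym (a₁ x c)) (sym (a₂ x c)))
          (cong f (sym (a₃ x c)))) (cong f (sym (a₄ x c)))) (eq (x + c)))
      period-A : Period (+ P) A
      period-A = period-c-1 (λ x → cong₂ _+_ (period-translate (c + 1ℤ) pf x) (pf x)) (antiperiod⇒period {A} anti-A)
      swap : ∀ x a b → x + a + b ≡ x + b + a
      swap = solve-∀
      regroup : ∀ u v w z → u - v + (w - z) ≡ u + w - (v + z)
      regroup = solve-∀
      anti-Δ : ∀ x → Δ P f (x + (c + 1ℤ)) + Δ P f x ≡ 0ℤ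
      anti-Δ x = trans (regroup (f (x + (c + 1ℤ) + + P)) (f (x + (c + 1ℤ))) (f (x + + P)) (f x))
        (trans (cong (λ z → f z + f (x + + P) - A x) (swap x (c + 1ℤ) (+ P)))
          (trans (cong (_- A x) (period-A x)) (+-inverseʳ (A x))))

  module _ (p : ℕ) (pp : Prime p) (2∤p : ¬ 2 ℕ.∣ p) (P : ℕ) .{{_ : ℕ.NonZero P}}
           (2∣P : 2 ℕ.∣ P) (3∣P : 3 ℕ.∣ P) (c : ℤ)
           (5∤c²-1 : p ≡ 5 → ¬ 5 ℕ.∣ P → (¬ + 5 ∣ c - 1ℤ) × (¬ + 5 ∣ c + 1ℤ))
           (period-c-1 : ∀ {u} → Period (+ (p ℕ.* P)) u → Period (+ 2 * (c - 1ℤ)) u → Period (+ P) u)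
           (period-c+1 : ∀ {u} → Period (+ (p ℕ.* P)) u → Period (+ 2 * (c + 1ℤ)) u → Period (+ P) u)
           (h : ℕ) (pP≡2h : p ℕ.* P ≡ h ℕ.+ h)
           (f : ℤ → ℤ) (pf : Period (+ (p ℕ.* P)) f) (B : ℕ) (fB : ∀ x → ∣ f x ∣ ℕ.≤ B) (r : ℤ)
           (magic : ∀ x → f x + f (x + 1ℤ) + f (x - 1ℤ) + f (x + c) + f (x - c) + f (x + + h) ≡ r) where

    magic⇒period : Period (+ P) f
    magic⇒period x = *-cancelˡ-≡ (+ 2) _ _ (begin
      + 2 * f (x + + P)                         ≡⟨ l₁ (f (x + + P)) (f (x + + P + + h)) (f x) (f (x + + h)) ⟩
      Δ P f⁺ x + Δ P f⁻ x + + 2 * f x           ≡⟨ cong₂ (λ u v → u + v + + 2 * f x) (Δ⁺ x) (Δ⁻ x) ⟩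
      0ℤ + 0ℤ + + 2 * f x                       ≡⟨ +-identityˡ (+ 2 * f x) ⟩
      + 2 * f x ∎)
      where
      f⁺ f⁻ : ℤ → ℤ
      f⁺ x = f x + f (x + + h)
      f⁻ x = f x - f (x + + h)
      l₁ : ∀ a b u v → + 2 * a ≡ a + b - (u + v) + (a - b - (u - v)) + + 2 * u
      l₁ = solve-∀
      wrap : ∀ x → f (x + + h + + h) ≡ f x
      wrap x = trans (cong f (trans (+-assoc x (+ h) (+ h)) (cong (λ z → x + + z) (sym pP≡2h)))) (pf x)
      swap : ∀ x h a → x + h + a ≡ x + a + h
      swap = solve-∀
      magic′ : ∀ x → f (x + + h) + f (x + 1ℤ + + h) + f (x - 1ℤ + + h) + f (x + c + + h) + f (x - c + + h) + f x ≡ r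
      magic′ x = trans (cong₂ _+_ (cong₂ _+_ (cong₂ _+_ (cong₂ _+_ (cong (λ z → f (x + + h) + f z)
        (sym (swap x (+ h) 1ℤ))) (cong f (sym (swap x (+ h) (- 1ℤ))))) (cong f (sym (swap x (+ h) c))))
        (cong f (sym (swap x (+ h) (- c))))) (sym (wrap x))) (magic (x + + h))
      f⁺-eq : ∀ x → shifts (neighbours c) f⁺ x ≡ r + r
      f⁺-eq x = begin
        shifts (neighbours c) f⁺ x
          ≡⟨ cong (λ z → f⁺ z + (f⁺ z + (f⁺ (x + 1ℤ) + (f⁺ (x + - 1ℤ) + (f⁺ (x + c) + (f⁺ (x + - c) + 0ℤ))))))
               (+-identityʳ x) ⟩
        f⁺ x + (f⁺ x + (f⁺ (x + 1ℤ) + (f⁺ (x + - 1ℤ) + (f⁺ (x + c) + (f⁺ (x + - c) + 0ℤ)))))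
          ≡⟨ add (f x) (f (x + + h)) (f (x + 1ℤ)) (f (x + 1ℤ + + h)) (f (x - 1ℤ)) (f (x - 1ℤ + + h))
               (f (x + c)) (f (x + c + + h)) (f (x - c)) (f (x - c + + h)) ⟩
        f x + f (x + 1ℤ) + f (x - 1ℤ) + f (x + c) + f (x - c) + f (x + + h) +
        (f (x + + h) + f (x + 1ℤ + + h) + f (x - 1ℤ + + h) + f (x + c + + h) + f (x - c + + h) + f x)
          ≡⟨ cong₂ _+_ (magic x) (magic′ x) ⟩
        r + r ∎
        where
        add : ∀ o o' a a' b b' d d' e e' →
          o + o' + (o + o' + (a + a' + (b + b' + (d + d' + (e + e' + 0ℤ))))) ≡
          o + a + b + d + e + o' + (o' + a' + b' + d' + e' + o)
        add = solve-∀
      f⁻-eq : ∀ x → f⁻ (x + 1ℤ) + f⁻ (x - 1ℤ) + f⁻ (x + c) + f⁻ (x - c) ≡ 0ℤ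
      f⁻-eq x = begin
        f⁻ (x + 1ℤ) + f⁻ (x - 1ℤ) + f⁻ (x + c) + f⁻ (x - c)
          ≡⟨ sub (f x) (f (x + + h)) (f (x + 1ℤ)) (f (x + 1ℤ + + h)) (f (x - 1ℤ)) (f (x - 1ℤ + + h))
               (f (x + c)) (f (x + c + + h)) (f (x - c)) (f (x - c + + h)) ⟩
        f x + f (x + 1ℤ) + f (x - 1ℤ) + f (x + c) + f (x - c) + f (x + + h) -
        (f (x + + h) + f (x + 1ℤ + + h) + f (x - 1ℤ + + h) + f (x + c + + h) + f (x - c + + h) + f x)
          ≡⟨ cong₂ _-_ (magic x) (magic′ x) ⟩
        r - r
          ≡⟨ +-inverseʳ r ⟩
        0ℤ ∎
        where
        sub : ∀ o o' a a' b b' d d' e e' →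
          a - a' + (b - b') + (d - d') + (e - e') ≡
          o + a + b + d + e + o' - (o' + a' + b' + d' + e' + o)
        sub = solve-∀
      Δ⁺ : ∀ x → Δ P f⁺ x ≡ 0ℤ
      Δ⁺ = Δ≡0 p pp 2∤p P 2∣P 3∣P c {f⁺} (λ x → cong₂ _+_ (pf x) (period-translate (+ h) pf x)) (B ℕ.+ B)
        (λ x → ℕ.≤-trans (∣i+j∣≤∣i∣+∣j∣ (f x) (f (x + + h))) (ℕ.+-mono-≤ (fB x) (fB (x + + h)))) (r + r) f⁺-eq 5∤c²-1
      Δ⁻ : ∀ x → Δ P f⁻ x ≡ 0ℤ
      Δ⁻ = odd-Δ≡0 p {{prime⇒nonZero pp}} P c period-c-1 period-c+1 {f⁻}
        (λ x → cong₂ _-_ (pf x) (period-translate (+ h) pf x)) f⁻-eq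

module Labelling where

  open Periodic using (Period)
  open import Defs using (Graph; Cay; connectionSet; residue)
  open import Data.Nat as ℕ using (ℕ; zero; suc; _∸_; s≤s; z≤n)
  import Data.Nat.Properties as ℕ
  import Data.Nat.Divisibility as ℕ
  import Data.Nat.DivMod as ℕ
  open import Data.Nat.ListAction using (sum)
  open import Data.Nat.ListAction.Properties using (sum-↭)
  open import Data.Fin as Fin using (Fin; toℕ)
  open import Data.Fin.Properties using (toℕ-fromℕ<; toℕ-injective; toℕ<n)
  open import Data.Fin.Subset using (⁅_⁆) renaming (_∈_ to _∈ₛ_)
  open import Data.Fin.Subset.Properties using (x∈p∪q⁺; x∈p∪q⁻; x∈⁅x⁆; x∈⁅y⁆⇒x≡y)
  open import Data.Integer hiding (suc)
  open import Data.Integer.Properties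
  open import Data.Integer.DivMod using (_%ℕ_; _/ℕ_; n%ℕd<d; a≡a%ℕn+[a/ℕn]*n)
  open import Data.Integer.Divisibility.Signed
  open import Data.Integer.Tactic.RingSolver using (solve-∀)
  open import Data.List using (List; []; _∷_; map; filter; allFin)
  open import Data.List.Membership.Propositional using (_∈_)
  open import Data.List.Membership.Propositional.Properties using (∈-filter⁺; ∈-filter⁻; ∈-allFin; ∈-map⁻; ∈-map⁺)
  open import Data.List.Membership.Propositional.Properties.WithK using (unique∧set⇒bag)
  open import Data.List.Relation.Binary.BagAndSetEquality using (∼bag⇒↭)
  open import Data.List.Relation.Binary.Permutation.Propositional.Properties using () renaming (map⁺ to ↭-map⁺)
  open import Data.List.Relation.Unary.All as All using (All; []; _∷_)
  open import Data.List.Relation.Unary.AllPairs as AllPairs using (AllPairs; []; _∷_)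
  import Data.List.Relation.Unary.AllPairs.Properties as AllPairs
  open import Data.List.Relation.Unary.Any using (here; there)
  open import Data.List.Relation.Unary.Linked using (Linked; []; [-]; _∷_)
  open import Data.List.Relation.Unary.Linked.Properties using (Linked⇒AllPairs)
  open import Data.List.Relation.Unary.Unique.Propositional using (Unique)
  import Data.List.Relation.Unary.Unique.Propositional.Properties as Unique
  open import Data.Product using (_×_; _,_; ∃-syntax; proj₁; proj₂)
  open import Data.Sum using (_⊎_; inj₁; inj₂)
  open import Data.Empty using (⊥-elim)
  open import Function using (_∘_; mk⇔; _⤖_; module Bijection)
  open import Relation.Nullary.Decidable using (_⊎-dec_)
  open import Relation.Binary.PropositionalEquality

  module Residue (n : ℕ) .{{_ : ℕ.NonZero n}} where

    infix 4 _∼_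
    record _∼_ (x y : ℤ) : Set where
      constructor congruent
      field n∣x-y : + n ∣ x - y
    open _∼_ public

    ∼-reflexive : ∀ {x y} → x ≡ y → x ∼ y
    ∼-reflexive {x} refl = congruent (divides 0ℤ (+-inverseʳ x))

    ∼-sym : ∀ {x y} → x ∼ y → y ∼ x
    ∼-sym {x} {y} (congruent d) = congruent (subst (+ n ∣_) (lemma x y) (∣m⇒∣-m d))
      where
      lemma : ∀ x y → - (x - y) ≡ y - x
      lemma = solve-∀

    ∼-trans : ∀ {x y z} → x ∼ y → y ∼ z → x ∼ z
    ∼-trans {x} {y} {z} (congruent d) (congruent e) = congruent (subst (+ n ∣_) (lemma x y z) (∣m∣n⇒∣m+n d e))
      where
      lemma : ∀ x y z → x - y + (y - z) ≡ x - z
      lemma = solve-∀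

    ∼-+ : ∀ {x y} a → x ∼ y → x + a ∼ y + a
    ∼-+ {x} {y} a (congruent d) = congruent (subst (+ n ∣_) (lemma x y a) d)
      where
      lemma : ∀ x y a → x - y ≡ x + a - (y + a)
      lemma = solve-∀

    ∼-%ℕ : ∀ x → x ∼ + (x %ℕ n)
    ∼-%ℕ x = congruent (divides (x /ℕ n) (trans (cong (_- + (x %ℕ n)) (a≡a%ℕn+[a/ℕn]*n x n))
      (lemma (+ (x %ℕ n)) (x /ℕ n * + n))))
      where
      lemma : ∀ r y → r + y - r ≡ y
      lemma = solve-∀

    toℕ-residue : ∀ x → toℕ (residue n x) ≡ x %ℕ n
    toℕ-residue x = toℕ-fromℕ< (n%ℕd<d x n)

    ∼⇒≡ : ∀ {a b} → a ℕ.< n → b ℕ.< n → + a ∼ + b → a ≡ b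
    ∼⇒≡ {a} {b} a<n b<n d = +-injective (i-j≡0⇒i≡j (+ a) (+ b) (∣i∣≡0⇒i≡0 (small (∣⇒∣ᵤ (n∣x-y d)) bound)))
      where
      small : ∀ {m} → n ℕ.∣ m → m ℕ.< n → m ≡ 0
      small {zero}  _ _   = refl
      small {suc m} n∣m m<n = ⊥-elim (ℕ.<⇒≱ m<n (ℕ.∣⇒≤ n∣m))
      bound : ∣ + a - + b ∣ ℕ.< n
      bound = subst (ℕ._< n) (cong ∣_∣ (sym (m-n≡m⊖n a b)))
        (ℕ.≤-<-trans (∣m⊝n∣≤m⊔n a b) (ℕ.⊔-lub a<n b<n))

    ∼⇒residue≡ : ∀ {x y} → x ∼ y → residue n x ≡ residue n y
    ∼⇒residue≡ {x} {y} d = toℕ-injective (trans (toℕ-residue x) (trans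
      (∼⇒≡ (n%ℕd<d x n) (n%ℕd<d y n) (∼-trans (∼-sym (∼-%ℕ x)) (∼-trans d (∼-%ℕ y)))) (sym (toℕ-residue y))))

    ∼-toℕ-residue : ∀ x → + toℕ (residue n x) ∼ x
    ∼-toℕ-residue x = ∼-sym (subst (λ r → x ∼ + r) (sym (toℕ-residue x)) (∼-%ℕ x))

    residue≡⇒∼ : ∀ {x y} → residue n x ≡ residue n y → x ∼ y
    residue≡⇒∼ {x} {y} eq = ∼-trans (∼-sym (∼-toℕ-residue x))
      (∼-trans (∼-reflexive (cong (+_ ∘ toℕ) eq)) (∼-toℕ-residue y))

    residue-toℕ : ∀ v → residue n (+ toℕ v) ≡ v
    residue-toℕ v = toℕ-injective (∼⇒≡ (toℕ<n (residue n (+ toℕ v))) (toℕ<n v) (∼-toℕ-residue (+ toℕ v)))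

  module Neighbourhood (n : ℕ) .{{_ : ℕ.NonZero n}} (c : ℕ) (6≤n : 6 ℕ.≤ n) (2∣n : 2 ℕ.∣ n) (1<c : 1 ℕ.< c)
                       (c<h : c ℕ.< n ℕ./ 2) where

    open Residue n

    h : ℕ
    h = n ℕ./ 2

    n≡h+h : n ≡ h ℕ.+ h
    n≡h+h = trans (sym (ℕ.m/n*n≡m 2∣n)) (trans (ℕ.*-comm h 2) (cong (h ℕ.+_) (ℕ.+-identityʳ h)))

    private
      c<n : c ℕ.< n
      c<n = ℕ.<-≤-trans c<h (subst (h ℕ.≤_) (sym n≡h+h) (ℕ.m≤m+n h h))

      h<n∸c : h ℕ.< n ∸ c
      h<n∸c = subst (ℕ._≤ n ∸ c) (ℕ.m+n∸n≡m (suc h) c)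
        (ℕ.∸-monoˡ-≤ c (subst (suc h ℕ.+ c ℕ.≤_) (sym n≡h+h)
          (subst (ℕ._≤ h ℕ.+ h) (ℕ.+-suc h c) (ℕ.+-monoʳ-≤ h c<h))))

      n∸c<n∸1 : n ∸ c ℕ.< n ∸ 1
      n∸c<n∸1 = ℕ.∸-monoʳ-< 1<c (ℕ.<⇒≤ c<n)

      n∸1<n : n ∸ 1 ℕ.< n
      n∸1<n = ℕ.∸-monoʳ-< {o = 0} (s≤s z≤n) (ℕ.≤-trans (s≤s z≤n) 6≤n)

    -- The offsets of the closed neighbourhood 0, 1, c, n/2, −c, −1, as residues in increasing order.
    offsets : List ℕ
    offsets = 0 ∷ 1 ∷ c ∷ h ∷ n ∸ c ∷ n ∸ 1 ∷ []

    offsets-increasing : Linked ℕ._<_ offsets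
    offsets-increasing = s≤s z≤n ∷ 1<c ∷ c<h ∷ h<n∸c ∷ n∸c<n∸1 ∷ [-]

    offsets<n : All (ℕ._< n) offsets
    offsets<n = ℕ.<-trans (s≤s z≤n) (ℕ.<-trans 1<c c<n) ∷ ℕ.<-trans 1<c c<n ∷ c<n ∷
      ℕ.<-trans h<n∸c (ℕ.<-trans n∸c<n∸1 n∸1<n) ∷ ℕ.<-trans n∸c<n∸1 n∸1<n ∷ n∸1<n ∷ []

    closedNeighbours : ℤ → List (Fin n)
    closedNeighbours x = map (λ o → residue n (x + + o)) offsets

    closedNeighbours-unique : ∀ x → Unique (closedNeighbours x)
    closedNeighbours-unique x = AllPairs.map⁺ (distinct (Linked⇒AllPairs ℕ.<-trans offsets-increasing) offsets<n)
      where
      back : ∀ x a → x + a - x ≡ a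
      back = solve-∀
      residues-distinct : ∀ {a b} → a ℕ.< n → b ℕ.< n → a ℕ.< b → residue n (x + + a) ≢ residue n (x + + b)
      residues-distinct {a} {b} a<n b<n a<b eq = ℕ.<⇒≢ a<b (∼⇒≡ a<n b<n
        (subst₂ _∼_ (back x (+ a)) (back x (+ b)) (∼-+ (- x) (residue≡⇒∼ {x + + a} {x + + b} eq))))
      distinct : ∀ {os} → AllPairs ℕ._<_ os → All (ℕ._< n) os →
        AllPairs (λ a b → residue n (x + + a) ≢ residue n (x + + b)) os
      distinct []         []         = []
      distinct (lt ∷ lts) (b ∷ bs) =
        All.zipWith (λ (a<o , o<n) → residues-distinct b o<n a<o) (lt , bs) ∷ distinct lts bs

    steps : List ℤ
    steps = 1ℤ ∷ - 1ℤ ∷ + c ∷ - + c ∷ + h ∷ []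

    ∈connectionSet⁻ : ∀ {v} → v ∈ₛ connectionSet n c → ∃[ s ] (s ∈ steps × v ≡ residue n s)
    ∈connectionSet⁻ v∈ with x∈p∪q⁻ ⁅ residue n 1ℤ ⁆ _ v∈
    ... | inj₁ v∈₁ = 1ℤ , here refl , x∈⁅y⁆⇒x≡y _ v∈₁
    ... | inj₂ v∈₁ with x∈p∪q⁻ ⁅ residue n (- 1ℤ) ⁆ _ v∈₁
    ...   | inj₁ v∈₂ = - 1ℤ , there (here refl) , x∈⁅y⁆⇒x≡y _ v∈₂
    ...   | inj₂ v∈₂ with x∈p∪q⁻ ⁅ residue n (+ c) ⁆ _ v∈₂
    ...     | inj₁ v∈₃ = + c , there (there (here refl)) , x∈⁅y⁆⇒x≡y _ v∈₃
    ...     | inj₂ v∈₃ with x∈p∪q⁻ ⁅ residue n (- + c) ⁆ _ v∈₃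
    ...       | inj₁ v∈₄ = - + c , there (there (there (here refl))) , x∈⁅y⁆⇒x≡y _ v∈₄
    ...       | inj₂ v∈₄ = + h , there (there (there (there (here refl)))) , x∈⁅y⁆⇒x≡y _ v∈₄

    ∈connectionSet⁺ : ∀ {s} → s ∈ steps → residue n s ∈ₛ connectionSet n c
    ∈connectionSet⁺ (here refl) = x∈p∪q⁺ (inj₁ (x∈⁅x⁆ _))
    ∈connectionSet⁺ (there (here refl)) = x∈p∪q⁺ (inj₂ (x∈p∪q⁺ (inj₁ (x∈⁅x⁆ _))))
    ∈connectionSet⁺ (there (there (here refl))) = x∈p∪q⁺ (inj₂ (x∈p∪q⁺ (inj₂ (x∈p∪q⁺ (inj₁ (x∈⁅x⁆ _))))))
    ∈connectionSet⁺ (there (there (there (here refl)))) =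
      x∈p∪q⁺ (inj₂ (x∈p∪q⁺ (inj₂ (x∈p∪q⁺ (inj₂ (x∈p∪q⁺ (inj₁ (x∈⁅x⁆ _))))))))
    ∈connectionSet⁺ (there (there (there (there (here refl))))) =
      x∈p∪q⁺ (inj₂ (x∈p∪q⁺ (inj₂ (x∈p∪q⁺ (inj₂ (x∈p∪q⁺ (inj₂ (x∈⁅x⁆ _))))))))

    ∼-∸ : ∀ {a} → a ℕ.≤ n → + (n ∸ a) ∼ - + a
    ∼-∸ {a} a≤n = congruent (divides 1ℤ (trans (cong (λ z → + (n ∸ a) + z) (neg-involutive (+ a)))
      (trans (cong +_ (ℕ.m∸n+n≡m a≤n)) (sym (*-identityˡ (+ n))))))

    step⇒offset : ∀ {s} → s ∈ steps → ∃[ o ] (o ∈ offsets × + o ∼ s)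
    step⇒offset (here refl) = 1 , there (here refl) , ∼-reflexive refl
    step⇒offset (there (here refl)) =
      n ∸ 1 , there (there (there (there (there (here refl))))) , ∼-∸ (ℕ.≤-trans (s≤s z≤n) 6≤n)
    step⇒offset (there (there (here refl))) = c , there (there (here refl)) , ∼-reflexive refl
    step⇒offset (there (there (there (here refl)))) =
      n ∸ c , there (there (there (there (here refl)))) , ∼-∸ (ℕ.<⇒≤ c<n)
    step⇒offset (there (there (there (there (here refl))))) = h , there (there (there (here refl))) , ∼-reflexive refl

    offset⇒step : ∀ {o} → o ∈ offsets → o ≡ 0 ⊎ ∃[ s ] (s ∈ steps × + o ∼ s)
    offset⇒step (here refl) = inj₁ refl
    offset⇒step (there (here refl)) = inj₂ (1ℤ , here refl , ∼-reflexive refl)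
    offset⇒step (there (there (here refl))) = inj₂ (+ c , there (there (here refl)) , ∼-reflexive refl)
    offset⇒step (there (there (there (here refl)))) =
      inj₂ (+ h , there (there (there (there (here refl)))) , ∼-reflexive refl)
    offset⇒step (there (there (there (there (here refl))))) =
      inj₂ (- + c , there (there (there (here refl))) , ∼-∸ (ℕ.<⇒≤ c<n))
    offset⇒step (there (there (there (there (there (here refl)))))) =
      inj₂ (- 1ℤ , there (here refl) , ∼-∸ (ℕ.≤-trans (s≤s z≤n) 6≤n))

    Γ : Graph n
    Γ = Cay n (connectionSet n c)

    open Graph Γ

    ∈closedNeighbours⁺ : ∀ x {v} → v ≡ residue n x ⊎ Adj (residue n x) v → v ∈ closedNeighbours x
    ∈closedNeighbours⁺ x (inj₁ refl) = here (cong (residue n) (sym (+-identityʳ x)))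
    ∈closedNeighbours⁺ x {v} (inj₂ adj) with ∈connectionSet⁻ adj
    ... | s , s∈ , eq with step⇒offset s∈
    ...   | o , o∈ , o∼s = subst (_∈ closedNeighbours x) (trans (sym (∼⇒residue≡ v∼)) (residue-toℕ v))
              (∈-map⁺ (λ o → residue n (x + + o)) o∈)
      where
      u = + toℕ (residue n x)
      lemma : ∀ v u → v - u + u ≡ v
      lemma = solve-∀
      v∼ : + toℕ v ∼ x + + o
      v∼ = subst₂ _∼_ (lemma (+ toℕ v) u) (+-comm (+ o) x)
        (∼-trans (∼-+ u (residue≡⇒∼ {+ toℕ v - u} {s} eq)) (∼-trans (∼-+ u (∼-sym o∼s))
          (subst₂ _∼_ (+-comm u (+ o)) (+-comm x (+ o)) (∼-+ (+ o) (∼-toℕ-residue x)))))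

    ∈closedNeighbours⁻ : ∀ x {v} → v ∈ closedNeighbours x → v ≡ residue n x ⊎ Adj (residue n x) v
    ∈closedNeighbours⁻ x v∈ with ∈-map⁻ (λ o → residue n (x + + o)) v∈
    ... | o , o∈ , refl with offset⇒step o∈
    ...   | inj₁ refl = inj₁ (cong (residue n) (+-identityʳ x))
    ...   | inj₂ (s , s∈ , o∼s) = inj₂ (subst (_∈ₛ connectionSet n c) (sym (∼⇒residue≡ diff)) (∈connectionSet⁺ s∈))
      where
      u = + toℕ (residue n x)
      v = + toℕ (residue n (x + + o))
      lemma : ∀ x o → x + o + - x ≡ o
      lemma = solve-∀
      diff : v - u ∼ s
      diff = ∼-trans (∼-+ (- u) (∼-toℕ-residue (x + + o)))
        (∼-trans (subst₂ _∼_ (swap (+ o) x u) (swap′ (+ o) x u)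
          (∼-+ (+ o - u) (∼-sym (∼-toℕ-residue x))))
          (∼-trans (∼-reflexive (lemma x (+ o))) o∼s))
        where
        swap : ∀ o x u → x + (o - u) ≡ x + o - u
        swap = solve-∀
        swap′ : ∀ o x u → u + (o - u) ≡ x + o - x
        swap′ = solve-∀

    sum-closedNeighbours : ∀ (label : Fin n → ℕ) x →
      sum (map label (filter (λ v → (v Fin.≟ residue n x) ⊎-dec adj? (residue n x) v) (allFin n))) ≡
      sum (map label (closedNeighbours x))
    sum-closedNeighbours label x = sum-↭ (↭-map⁺ label (∼bag⇒↭ (unique∧set⇒bag
      (Unique.filter⁺ P? (Unique.allFin⁺ n)) (closedNeighbours-unique x)
      (λ {v} → mk⇔ (∈closedNeighbours⁺ x ∘ proj₂ ∘ ∈-filter⁻ P? {xs = allFin n})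
           (λ v∈ → ∈-filter⁺ P? (∈-allFin v) (∈closedNeighbours⁻ x v∈))))))
      where P? = λ v → (v Fin.≟ residue n x) ⊎-dec adj? (residue n x) v

    module Labels (φ : Fin n ⤖ Fin n) (r : ℕ) (magic : ∀ u →
      sum (map (λ v → suc (toℕ (Bijection.to φ v)))
               (filter (λ v → (v Fin.≟ u) ⊎-dec adj? u v) (allFin n))) ≡ r) where

      label : Fin n → ℕ
      label v = suc (toℕ (Bijection.to φ v))

      f : ℤ → ℤ
      f x = + label (residue n x)

      f-cong : ∀ {x y} → x ∼ y → f x ≡ f y
      f-cong {x} {y} d = cong (+_ ∘ label) (∼⇒residue≡ {x} {y} d)

      f-injective : ∀ {x y} → f x ≡ f y → x ∼ y
      f-injective {x} {y} eq =
        residue≡⇒∼ {x} {y} (Bijection.injective φ (toℕ-injective (ℕ.suc-injective (+-injective eq))))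

      f-period : Period (+ n) f
      f-period x = f-cong {x + + n} {x} (congruent (divides 1ℤ (lemma x (+ n))))
        where
        lemma : ∀ x n → x + n - x ≡ 1ℤ * n
        lemma = solve-∀

      f-bound : ∀ x → ∣ f x ∣ ℕ.≤ n
      f-bound x = toℕ<n (Bijection.to φ (residue n x))

      f-magic : ∀ x → f x + f (x + 1ℤ) + f (x - 1ℤ) + f (x + + c) + f (x - + c) + f (x + + h) ≡ + r
      f-magic x = trans (reorder (f x) (f (x + 1ℤ)) (f (x - 1ℤ)) (f (x + + c)) (f (x - + c)) (f (x + + h)))
        (trans (cong₂ (λ a z → a + (f (x + 1ℤ) + (f (x + + c) + (f (x + + h) + z))))
            (cong f (sym (+-identityʳ x)))
            (cong₂ (λ a b → a + (b + 0ℤ)) (wrap c (ℕ.<⇒≤ c<n)) (wrap 1 (ℕ.≤-trans (s≤s z≤n) 6≤n))))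
          (cong +_ (trans (sym (sum-closedNeighbours label x)) (magic (residue n x)))))
        where
        reorder : ∀ o a a' b b' d → o + a + a' + b + b' + d ≡ o + (a + (b + (d + (b' + (a' + 0ℤ)))))
        reorder = solve-∀
        wrap : ∀ a → a ℕ.≤ n → f (x - + a) ≡ f (x + + (n ∸ a))
        wrap a a≤n = f-cong (subst₂ _∼_ (+-comm (- + a) x) (+-comm (+ (n ∸ a)) x) (∼-+ x (∼-sym (∼-∸ a≤n))))

module ThirdTurns where

  open import Defs using (π; _≈_; ⟪_,_⟫; angle; thirdTurn; Type2)
  open import Data.Nat as ℕ using (ℕ; zero; suc; _!)
  import Data.Nat.Properties as ℕ
  import Data.Nat.Divisibility as ℕ
  open import Data.Nat.Primality using (prime?; euclidsLemma)
  open import Data.Integer as ℤ using (+_; _◃_)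
  import Data.Integer.Properties as ℤ
  open import Data.Integer.Divisibility.Signed
  open import Data.Integer.Tactic.RingSolver using (solve-∀)
  open import Data.Rational
  open import Data.Rational.Properties
  open import Data.Rational.Solver using (module +-*-Solver)
  import Data.Rational.Unnormalised as ℚᵘ
  import Data.Rational.Unnormalised.Properties as ℚᵘ
  open import Data.Fin using (toℕ)
  open import Data.Product using (_×_; _,_; ∃-syntax)
  open import Data.Sign as Sign using ()
  open import Data.Sum using (inj₁; inj₂)
  open import Data.Empty using (⊥-elim)
  open import Relation.Nullary using (¬_; yes; no)
  open import Relation.Nullary.Decidable using (from-no; from-yes)
  open import Relation.Binary.PropositionalEquality

  1≤π : ∀ m → 1ℚ ≤ π m
  1≤π m = ≤-trans (from-yes (1ℚ ≤? π 0)) (increasing m)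
    where
    term : ℕ → ℚ
    term k = ((+ (2 ℕ.^ suc k ℕ.* (k !) ℕ.* (k !))) / (suc (2 ℕ.* k) !)) {{suc (2 ℕ.* k) ℕ.!≢0}}
    increasing : ∀ m → π 0 ≤ π m
    increasing zero    = ≤-refl
    increasing (suc m) = ≤-trans (increasing m) (subst (_≤ π (suc m)) (+-identityʳ (π m))
      (+-monoʳ-≤ (π m) (nonNegative⁻¹ (term (suc m))
        {{normalize-nonNeg (2 ℕ.^ suc (suc m) ℕ.* (suc m !) ℕ.* (suc m !)) (suc (2 ℕ.* suc m) !)
           {{suc (2 ℕ.* suc m) ℕ.!≢0}}}})))

  qπ→0⇒q≡0 : ∀ q → (∀ ε → 0ℚ < ε → ∃[ N ] (∀ m → N ℕ.≤ m → ∣ q * π m ∣ < ε)) → q ≡ 0ℚ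
  qπ→0⇒q≡0 q lim with q ≟ 0ℚ
  ... | yes q≡0 = q≡0
  ... | no  q≢0 with lim ∣ q ∣ (≰⇒> λ ∣q∣≤0 → q≢0 (∣p∣≡0⇒p≡0 q (≤-antisym ∣q∣≤0 (0≤∣p∣ q))))
  ...   | N , close = ⊥-elim (<-irrefl refl (<-≤-trans (close N ℕ.≤-refl) (subst₂ _≤_ (*-identityʳ ∣ q ∣)
          (trans (cong (∣ q ∣ *_) (sym (0≤p⇒∣p∣≡p (≤-trans (from-yes (0ℚ ≤? 1ℚ)) (1≤π N))))) (sym (∣p*q∣≡∣p∣*∣q∣ q (π N))))
          (*-monoˡ-≤-nonNeg ∣ q ∣ {{nonNegative (0≤∣p∣ q)}} (1≤π N)))))

  angle≈thirdTurn : ∀ n .{{_ : ℕ.NonZero n}} a s k → angle n a ≈ thirdTurn s k →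
    + 3 ℤ.* (+ 2 ℤ.* + a) ≡ ((s ◃ 2) ℤ.+ + 6 ℤ.* k) ℤ.* + n
  angle≈thirdTurn n@(suc n-1) a s k eq = unpack (ℚᵘ.≃-trans (ℚᵘ.≃-sym (toℚᵘ-fromℚᵘ (ℚᵘ.mkℚᵘ (+ (2 ℕ.* a)) n-1)))
    (ℚᵘ.≃-trans (toℚᵘ-cong q≡) (ℚᵘ.≃-trans (toℚᵘ-homo-+ ((s ◃ 2) / 3) ((+ 2 ℤ.* k) / 1))
      (ℚᵘ.+-cong (toℚᵘ-fromℚᵘ (ℚᵘ.mkℚᵘ (s ◃ 2) 2)) (toℚᵘ-fromℚᵘ (ℚᵘ.mkℚᵘ (+ 2 ℤ.* k) 0))))))
    where
    u = (+ (2 ℕ.* a)) / n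
    v = (s ◃ 2) / 3
    w = (+ 2 ℤ.* k) / 1
    factor : ∀ u v w p → u * p - (v * p + w * p) ≡ (u - (v + w)) * p
    factor = solve 4 (λ u v w p → u :* p :- (v :* p :+ w :* p) := (u :- (v :+ w)) :* p) refl
      where open +-*-Solver
    q≡ : u ≡ v + w
    q≡ = p-q≡0⇒p≡q (qπ→0⇒q≡0 (u - (v + w)) (λ ε 0<ε → let (N , close) = eq ε 0<ε in
      N , λ m N≤m → subst (λ z → ∣ z ∣ < ε) (factor u v w (π m)) (close m N≤m)))
      where
      cancel : ∀ p q → p - q + q ≡ p
      cancel = solve 2 (λ p q → p :- q :+ q := p) refl
        where open +-*-Solver
      p-q≡0⇒p≡q : ∀ {p q} → p - q ≡ 0ℚ → p ≡ q
      p-q≡0⇒p≡q {p} {q} eq = trans (sym (cancel p q)) (trans (cong (_+ q) eq) (+-identityˡ q))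
    unpack : ℚᵘ.mkℚᵘ (+ (2 ℕ.* a)) n-1 ℚᵘ.≃ ℚᵘ.mkℚᵘ (s ◃ 2) 2 ℚᵘ.+ ℚᵘ.mkℚᵘ (+ 2 ℤ.* k) 0 →
      + 3 ℤ.* (+ 2 ℤ.* + a) ≡ ((s ◃ 2) ℤ.+ + 6 ℤ.* k) ℤ.* + n
    unpack (ℚᵘ.*≡* e) = trans (ℤ.*-comm (+ 3) (+ 2 ℤ.* + a)) (trans (cong (ℤ._* + 3) (sym (ℤ.pos-* 2 a)))
      (trans e (lemma (s ◃ 2) k (+ n))))
      where
      lemma : ∀ σ k n → (σ ℤ.* + 1 ℤ.+ + 2 ℤ.* k ℤ.* + 3) ℤ.* n ≡ (σ ℤ.+ + 6 ℤ.* k) ℤ.* n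
      lemma = solve-∀

  3∤thirdTurn : ∀ s k → ¬ + 3 ∣ (s ◃ 2) ℤ.+ + 6 ℤ.* k
  3∤thirdTurn s k 3∣ = 3∤ s (∣m+n∣n⇒∣m {n = + 6 ℤ.* k} 3∣ (∣m⇒∣m*n k (divides (+ 2) refl)))
    where
    3∤ : ∀ s → ¬ + 3 ∣ (s ◃ 2)
    3∤ Sign.+ = from-no (+ 3 ∣? + 2)
    3∤ Sign.- = from-no (+ 3 ∣? ℤ.- + 2)

  thirdTurns⇒3∣n∧3∤c : ∀ n .{{_ : ℕ.NonZero n}} c j {z z′} → ¬ + 3 ∣ z → ¬ + 3 ∣ z′ →
    + 3 ℤ.* (+ 2 ℤ.* + j) ≡ z ℤ.* + n → + 3 ℤ.* (+ 2 ℤ.* + (j ℕ.* c)) ≡ z′ ℤ.* + n → 3 ℕ.∣ n × ¬ 3 ℕ.∣ c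
  thirdTurns⇒3∣n∧3∤c n c j {z} {z′} 3∤z 3∤z′ eq eq′ = 3∣n , 3∤c
    where
    3∣n : 3 ℕ.∣ n
    3∣n with euclidsLemma ℤ.∣ z ∣ n (from-yes (prime? 3))
      (subst (3 ℕ.∣_) (ℤ.abs-* z (+ n)) (∣⇒∣ᵤ (subst (+ 3 ∣_) eq (∣m⇒∣m*n (+ 2 ℤ.* + j) ∣-refl))))
    ... | inj₁ 3∣z = ⊥-elim (3∤z (∣ᵤ⇒∣ 3∣z))
    ... | inj₂ 3∣n = 3∣n
    l₁ : ∀ j c → + 3 ℤ.* (+ 2 ℤ.* (j ℤ.* c)) ≡ + 3 ℤ.* (+ 2 ℤ.* j) ℤ.* c
    l₁ = solve-∀
    l₂ : ∀ z n c → z ℤ.* n ℤ.* c ≡ z ℤ.* c ℤ.* n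
    l₂ = solve-∀
    z′≡zc : z′ ≡ z ℤ.* + c
    z′≡zc = ℤ.*-cancelʳ-≡ z′ (z ℤ.* + c) (+ n) (trans (sym eq′) (trans
      (cong (λ a → + 3 ℤ.* (+ 2 ℤ.* a)) (ℤ.pos-* j c)) (trans (l₁ (+ j) (+ c))
      (trans (cong (ℤ._* + c) eq) (l₂ z (+ n) (+ c))))))
    3∤c : ¬ 3 ℕ.∣ c
    3∤c 3∣c = 3∤z′ (subst (+ 3 ∣_) (sym z′≡zc) (∣n⇒∣m*n z {+ c} (∣ᵤ⇒∣ 3∣c)))

  type2⇒3∣n∧3∤c : ∀ n .{{_ : ℕ.NonZero n}} c j → Type2 n c j → 3 ℕ.∣ n × ¬ 3 ℕ.∣ c
  type2⇒3∣n∧3∤c n c j (_ , _ , s₁ , s₂ , k₁ , k₂ , sub , _) =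
    let (_ , 3∤z  , eq)  = third (toℕ j) (sub {angle n (toℕ j)} (inj₁ (≈-refl (angle n (toℕ j)))))
        (_ , 3∤z′ , eq′) = third (toℕ j ℕ.* c) (sub {angle n (toℕ j ℕ.* c)} (inj₂ (≈-refl (angle n (toℕ j ℕ.* c)))))
    in thirdTurns⇒3∣n∧3∤c n c (toℕ j) 3∤z 3∤z′ eq eq′
    where
    ≈-refl : ∀ x → x ≈ x
    ≈-refl x ε 0<ε = 0 , λ m _ → subst (_< ε) (sym (cong ∣_∣ (+-inverseʳ (x m)))) 0<ε
    third : ∀ a → ⟪ thirdTurn s₁ k₁ , thirdTurn s₂ k₂ ⟫ (angle n a) →
      ∃[ z ] (¬ + 3 ∣ z × + 3 ℤ.* (+ 2 ℤ.* + a) ≡ z ℤ.* + n)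
    third a (inj₁ eq) = (s₁ ◃ 2) ℤ.+ + 6 ℤ.* k₁ , 3∤thirdTurn s₁ k₁ , angle≈thirdTurn n a s₁ k₁ eq
    third a (inj₂ eq) = (s₂ ◃ 2) ℤ.+ + 6 ℤ.* k₂ , 3∤thirdTurn s₂ k₂ , angle≈thirdTurn n a s₂ k₂ eq

open import Defs using (Cay; connectionSet; ClosedDistanceMagic; Type2)
open import Data.Nat using (ℕ; NonZero; _+_; _*_; _∸_; _^_; _/_; _≤_; _<_)
open import Data.Nat.Divisibility using (_∣_)
open import Data.Nat.GCD using (gcd)
open import Data.Product using (_×_; ∃-syntax)
open import Relation.Binary.PropositionalEquality using (_≡_)
open import Relation.Nullary using (¬_)
open import Data.Empty using (⊥-elim)
open import Data.Integer as ℤ using (+_)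
import Data.Integer.Divisibility.Signed as ℤ
import Data.Integer.Properties as ℤ
open import Data.List using ([]; _∷_)
open import Data.List.Relation.Unary.All using (_∷_)
open import Data.Nat using (zero; suc; _%_; s≤s; z≤n; ≢-nonZero; nonTrivial⇒n>1)
open import Data.Nat.Coprimality as Coprime using (Coprime; coprime-divisor; coprime-factors)
open import Data.Nat.Divisibility
open import Data.Nat.DivMod using (m≡m%n+[m/n]*n; m%n<n)
open import Data.Nat.GCD using (gcd[m,n]∣m; gcd[m,n]∣n; gcd-greatest; c*gcd[m,n]≡gcd[cm,cn])
open import Data.Nat.ListAction using (product)
open import Data.Nat.Primality using (Prime; prime?; prime⇒nonTrivial; prime⇒irreducible; euclidsLemma)
open import Data.Nat.Primality.Factorisation using (factorise)
open import Data.Nat.Properties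
open import Data.Nat.Tactic.RingSolver using (solve-∀)
open import Data.Product using (_,_; proj₁; proj₂)
open import Data.Sum using (_⊎_; inj₁; inj₂)
open import Relation.Binary.PropositionalEquality using (_≢_; refl; sym; trans; cong; subst)
open import Relation.Nullary.Decidable using (from-yes)
open Periodic using (Period; period-∣; period-gcd; prime∤⇒coprime; magic⇒period)
open Labelling using (module Residue; module Neighbourhood)
open ThirdTurns using (type2⇒3∣n∧3∤c)


prime-2 : Prime 2
prime-2 = from-yes (prime? 2)

odd⇒coprime-2^ : ∀ {m} → ¬ 2 ∣ m → ∀ k → Coprime m (2 ^ k)
odd⇒coprime-2^ 2∤m k {d} (d∣m , d∣2^k) = go k d∣2^k
  where
  go : ∀ k → d ∣ 2 ^ k → d ≡ 1
  go zero    d∣1 = ∣1⇒≡1 d∣1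
  go (suc k) d∣  = go k (coprime-divisor (prime∤⇒coprime prime-2 (λ 2∣d → 2∤m (∣-trans 2∣d d∣m))) d∣)

odd∣2^k*m : ∀ {d} → ¬ 2 ∣ d → ∀ k {m} → d ∣ 2 ^ k * m → d ∣ m
odd∣2^k*m 2∤d k = coprime-divisor (odd⇒coprime-2^ 2∤d k)

common-divisor : ∀ {g ℓ} → ¬ 2 ∣ ℓ → ∀ t k ℓ′ → g ∣ 2 ^ t * ℓ → g ∣ 2 ^ k * ℓ′ → g ∣ 2 ^ t * gcd ℓ ℓ′
common-divisor {g} {ℓ} 2∤ℓ t k ℓ′ g∣ g∣′ with gcd[m,n]∣m ℓ ℓ′
... | divides m ℓ≡ = coprime-factors (odd⇒coprime-2^ 2∤m k)
        ( subst (g ∣_) (trans (cong (2 ^ t *_) ℓ≡) (x∙yz≈y∙xz (2 ^ t) m d)) g∣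
        , subst (g ∣_) (x∙yz≈y∙xz (2 ^ t) (2 ^ k) d) (subst (g ∣_) (cong (2 ^ t *_) (sym (c*gcd[m,n]≡gcd[cm,cn] (2 ^ k) ℓ ℓ′)))
            (subst (g ∣_) (sym (c*gcd[m,n]≡gcd[cm,cn] (2 ^ t) (2 ^ k * ℓ) (2 ^ k * ℓ′)))
              (gcd-greatest (subst (g ∣_) (x∙yz≈y∙xz (2 ^ k) (2 ^ t) ℓ) (∣n⇒∣m*n (2 ^ k) g∣)) (∣n⇒∣m*n (2 ^ t) g∣′)))))
  where
  d = gcd ℓ ℓ′
  x∙yz≈y∙xz : ∀ x y z → x * (y * z) ≡ y * (x * z)
  x∙yz≈y∙xz = solve-∀
  2∤m : ¬ 2 ∣ m
  2∤m 2∣m = 2∤ℓ (subst (2 ∣_) (sym ℓ≡) (∣m⇒∣m*n d 2∣m))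

3∣c-1⊎3∣c+1 : ∀ c → ¬ 3 ∣ c → 3 ∣ c ∸ 1 ⊎ 3 ∣ c + 1
3∣c-1⊎3∣c+1 c 3∤c with c % 3 in eq | c / 3 | m≡m%n+[m/n]*n c 3 | m%n<n c 3
... | 0 | q | _  | _ = ⊥-elim (3∤c (m%n≡0⇒n∣m c 3 eq))
... | 1 | q | c≡ | _ = inj₁ (divides q (cong (_∸ 1) c≡))
... | 2 | q | c≡ | _ = inj₂ (divides (suc q) (trans (cong (_+ 1) c≡) (+-comm (2 + q * 3) 1)))
... | suc (suc (suc _)) | _ | _ | s≤s (s≤s (s≤s ()))

module _ (n : ℕ) .{{_ : NonZero n}} (c-1 : ℕ) (6≤n : 6 ≤ n) (2∣n : 2 ∣ n)
         (1<c : 1 < suc c-1) (c<n/2 : suc c-1 < n / 2)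
         (cdm : ClosedDistanceMagic (Cay n (connectionSet n (suc c-1))))
         (t α β ℓ ℓ₁ ℓ₂ : ℕ) (2∤ℓ : ¬ 2 ∣ ℓ)
         (n≡ : n ≡ 2 ^ t * ℓ) (c+1≡ : suc c-1 + 1 ≡ 2 ^ α * ℓ₁) (c-1≡ : c-1 ≡ 2 ^ β * ℓ₂)
         (3∣n : 3 ∣ n) (3∤c : ¬ 3 ∣ suc c-1) where

  private
    c : ℕ
    c = suc c-1
    d₁ d₂ : ℕ
    d₁ = gcd ℓ ℓ₁
    d₂ = gcd ℓ ℓ₂

  d₁-d₂-coprime : Coprime d₁ d₂
  d₁-d₂-coprime {e} (e∣d₁ , e∣d₂) with prime⇒irreducible prime-2 e∣2
    where
    e∣2 : e ∣ 2
    e∣2 = ∣m+n∣m⇒∣n (subst (e ∣_) (trans (sym c+1≡) (lemma c-1))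
        (∣n⇒∣m*n (2 ^ α) (∣-trans e∣d₁ (gcd[m,n]∣n ℓ ℓ₁))))
      (subst (e ∣_) (sym c-1≡) (∣n⇒∣m*n (2 ^ β) (∣-trans e∣d₂ (gcd[m,n]∣n ℓ ℓ₂))))
      where
      lemma : ∀ b → suc b + 1 ≡ b + 2
      lemma = solve-∀
  ... | inj₁ e≡1  = e≡1
  ... | inj₂ refl = ⊥-elim (2∤ℓ (∣-trans e∣d₁ (gcd[m,n]∣m ℓ ℓ₁)))

  no-prime-cofactor : ∀ p r → Prime p → ¬ ℓ ≡ d₁ * d₂ * (p * r)
  no-prime-cofactor p r pp ℓ≡ = P≢0 (∼⇒≡ P<n 0<n (f-injective (subst (λ z → f z ≡ f (+ 0)) (ℤ.+-identityˡ (+ P)) (periodic (+ 0)))))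
    where
    open Neighbourhood n c 6≤n 2∣n 1<c c<n/2
    open Residue n
    open Labels (proj₁ cdm) (proj₁ (proj₂ cdm)) (proj₂ (proj₂ (proj₂ cdm)))
    P : ℕ
    P = 2 ^ t * (d₁ * d₂ * r)
    n≡pP : n ≡ p * P
    n≡pP = trans n≡ (trans (cong (2 ^ t *_) ℓ≡) (lemma (2 ^ t) d₁ d₂ p r))
      where
      lemma : ∀ a x y p r → a * (x * y * (p * r)) ≡ p * (a * (x * y * r))
      lemma = solve-∀
    0<n : 0 < n
    0<n = <-≤-trans (s≤s z≤n) 6≤n
    P≢0 : P ≢ 0
    P≢0 P≡0 = <⇒≢ 0<n (sym (trans n≡pP (trans (cong (p *_) P≡0) (*-zeroʳ p))))
    instance
      P-nonZero : NonZero P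
      P-nonZero = ≢-nonZero P≢0
    P<n : P < n
    P<n = subst (P <_) (sym n≡pP) (m<n*m P p (nonTrivial⇒n>1 p {{prime⇒nonTrivial pp}}))
      where
      m<n*m : ∀ m n .{{_ : NonZero m}} → 1 < n → m < n * m
      m<n*m m n 1<n = subst (_< n * m) (*-identityˡ m) (*-monoˡ-< m 1<n)
    p∣ℓ : p ∣ ℓ
    p∣ℓ = subst (p ∣_) (sym ℓ≡) (∣n⇒∣m*n (d₁ * d₂) (m∣m*n r))
    2∤p : ¬ 2 ∣ p
    2∤p 2∣p = 2∤ℓ (∣-trans 2∣p p∣ℓ)
    d₁∣P : 2 ^ t * d₁ ∣ P
    d₁∣P = *-monoʳ-∣ (2 ^ t) (∣m⇒∣m*n r (m∣m*n d₂))
    d₂∣P : 2 ^ t * d₂ ∣ P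
    d₂∣P = *-monoʳ-∣ (2 ^ t) (∣m⇒∣m*n r (n∣m*n d₁))
    p∣c-1⇒p∣P : p ∣ c-1 → p ∣ P
    p∣c-1⇒p∣P p∣ = ∣-trans (∣n⇒∣m*n (2 ^ t) (gcd-greatest p∣ℓ (odd∣2^k*m 2∤p β (subst (p ∣_) c-1≡ p∣)))) d₂∣P
    p∣c+1⇒p∣P : p ∣ c + 1 → p ∣ P
    p∣c+1⇒p∣P p∣ = ∣-trans (∣n⇒∣m*n (2 ^ t) (gcd-greatest p∣ℓ (odd∣2^k*m 2∤p α (subst (p ∣_) c+1≡ p∣)))) d₁∣P
    2∣P : 2 ∣ P
    2∣P with euclidsLemma p P prime-2 (subst (2 ∣_) n≡pP 2∣n)
    ... | inj₁ 2∣p = ⊥-elim (2∤p 2∣p)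
    ... | inj₂ 2∣P = 2∣P
    3∣P : 3 ∣ P
    3∣P with euclidsLemma p P (from-yes (prime? 3)) (subst (3 ∣_) n≡pP 3∣n)
    ... | inj₂ 3∣P = 3∣P
    ... | inj₁ 3∣p with prime⇒irreducible pp 3∣p
    ...   | inj₁ ()
    ...   | inj₂ 3≡p with 3∣c-1⊎3∣c+1 c 3∤c
    ...     | inj₁ 3∣c-1 = subst (_∣ P) (sym 3≡p) (p∣c-1⇒p∣P (subst (_∣ c-1) 3≡p 3∣c-1))
    ...     | inj₂ 3∣c+1 = subst (_∣ P) (sym 3≡p) (p∣c+1⇒p∣P (subst (_∣ c + 1) 3≡p 3∣c+1))
    5∤c²-1 : p ≡ 5 → ¬ 5 ∣ P → (¬ + 5 ℤ.∣ + c ℤ.- ℤ.1ℤ) × (¬ + 5 ℤ.∣ + c ℤ.+ ℤ.1ℤ)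
    5∤c²-1 p≡5 5∤P =
      (λ 5∣ → 5∤P (subst (_∣ P) p≡5 (p∣c-1⇒p∣P (subst (_∣ c-1) (sym p≡5) (ℤ.∣⇒∣ᵤ 5∣))))) ,
      (λ 5∣ → 5∤P (subst (_∣ P) p≡5 (p∣c+1⇒p∣P (subst (_∣ c + 1) (sym p≡5) (ℤ.∣⇒∣ᵤ 5∣)))))
    period-P : ∀ {k ℓ′ m} → m ≡ 2 ^ k * ℓ′ → 2 ^ t * gcd ℓ ℓ′ ∣ P →
      ∀ {u} → Period (+ (p * P)) u → Period (+ 2 ℤ.* + m) u → Period (+ P) u
    period-P {k} {ℓ′} {m} m≡ d∣P {u} pn pm = period-∣ {u} (∣-trans g∣ d∣P)
      (period-gcd {u} {p * P} {2 * m} pn (subst (λ a → Period a u) (sym (ℤ.pos-* 2 m)) pm))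
      where
      g∣ : gcd (p * P) (2 * m) ∣ 2 ^ t * gcd ℓ ℓ′
      g∣ = common-divisor 2∤ℓ t (suc k) ℓ′
        (subst (gcd (p * P) (2 * m) ∣_) (trans (sym n≡pP) n≡) (gcd[m,n]∣m (p * P) (2 * m)))
        (subst (gcd (p * P) (2 * m) ∣_) (trans (cong (2 *_) m≡) (sym (*-assoc 2 (2 ^ k) ℓ′))) (gcd[m,n]∣n (p * P) (2 * m)))
    periodic : Period (+ P) f
    periodic = magic⇒period p pp 2∤p P 2∣P 3∣P (+ c) 5∤c²-1
      (λ {u} → period-P {β} {ℓ₂} {c-1} c-1≡ d₂∣P {u}) (λ {u} → period-P {α} {ℓ₁} {c + 1} c+1≡ d₁∣P {u})
      h (trans (sym n≡pP) n≡h+h) f (subst (λ m → Period (+ m) f) n≡pP f-period) n f-bound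
      (+ proj₁ (proj₂ cdm)) f-magic

  ℓ≡d₁d₂ : ℓ ≡ d₁ * d₂
  ℓ≡d₁d₂ with gcd[m,n]∣m ℓ ℓ₁
  ... | divides m ℓ≡ with coprime-divisor (Coprime.sym d₁-d₂-coprime) (subst (d₂ ∣_) (trans ℓ≡ (*-comm m d₁)) (gcd[m,n]∣m ℓ ℓ₂))
  ...   | divides r m≡ = cofactor r (trans ℓ≡ (trans (cong (_* d₁) m≡) (lemma r d₂ d₁)))
    where
    lemma : ∀ r y x → r * y * x ≡ x * y * r
    lemma = solve-∀
    cofactor : ∀ r → ℓ ≡ d₁ * d₂ * r → ℓ ≡ d₁ * d₂
    cofactor zero      ℓ≡ = ⊥-elim (2∤ℓ (subst (2 ∣_) (sym (trans ℓ≡ (*-zeroʳ (d₁ * d₂)))) (2 ∣0)))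
    cofactor r@(suc _) ℓ≡ with factorise r
    ... | record { factors = [] ; isFactorisation = r≡1 } =
      trans ℓ≡ (trans (cong (d₁ * d₂ *_) r≡1) (*-identityʳ (d₁ * d₂)))
    ... | record { factors = p ∷ ps ; isFactorisation = r≡ ; factorsPrime = pp ∷ _ } =
      ⊥-elim (no-prime-cofactor p (product ps) pp (trans ℓ≡ (cong (d₁ * d₂ *_) r≡)))

proposition4p7 : ∀ (n : ℕ) .{{_ : NonZero n}} (c : ℕ) →
    6 ≤ n → 2 ∣ n → 1 < c → c < n / 2 →
    ClosedDistanceMagic (Cay n (connectionSet n c)) →
    ∀ (t α β ℓ ℓ₁ ℓ₂ : ℕ) →
    ¬ 2 ∣ ℓ → ¬ 2 ∣ ℓ₁ → ¬ 2 ∣ ℓ₂ →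
    n ≡ 2 ^ t * ℓ → c + 1 ≡ 2 ^ α * ℓ₁ → c ∸ 1 ≡ 2 ^ β * ℓ₂ →
    ∀ (d₁ d₂ n₁ n₂ : ℕ) →
    d₁ ≡ gcd ℓ ℓ₁ → d₂ ≡ gcd ℓ ℓ₂ →
    ℓ ≡ d₁ * n₁ → ℓ ≡ d₂ * n₂ →
    (∃[ j ] Type2 n c j) →
    ℓ ≡ d₁ * d₂ × n ≡ 2 ^ t * d₁ * d₂ × n₁ ≡ d₂ × n₂ ≡ d₁
proposition4p7 n c@(suc c-1) 6≤n 2∣n 1<c c<n/2 cdm t α β ℓ ℓ₁ ℓ₂ 2∤ℓ _ _ n≡ c+1≡ c-1≡ d₁ d₂ n₁ n₂
  refl refl ℓ≡d₁n₁ ℓ≡d₂n₂ (j , type2) =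
  ℓ≡ , trans n≡ (trans (cong (2 ^ t *_) ℓ≡) (sym (*-assoc (2 ^ t) d₁ d₂))) ,
  *-cancelˡ-≡ n₁ d₂ d₁ {{factor≢0 (gcd[m,n]∣m ℓ ℓ₁)}} (trans (sym ℓ≡d₁n₁) ℓ≡) ,
  *-cancelˡ-≡ n₂ d₁ d₂ {{factor≢0 (gcd[m,n]∣m ℓ ℓ₂)}} (trans (sym ℓ≡d₂n₂) (trans ℓ≡ (*-comm d₁ d₂)))
  where
  ℓ≡ : ℓ ≡ d₁ * d₂
  ℓ≡ = let (3∣n , 3∤c) = type2⇒3∣n∧3∤c n c j type2 in
    ℓ≡d₁d₂ n c-1 6≤n 2∣n 1<c c<n/2 cdm t α β ℓ ℓ₁ ℓ₂ 2∤ℓ n≡ c+1≡ c-1≡ 3∣n 3∤c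
  factor≢0 : ∀ {d} → d ∣ ℓ → NonZero d
  factor≢0 {zero}  0∣ℓ = ⊥-elim (2∤ℓ (subst (2 ∣_) (sym (0∣⇒≡0 0∣ℓ)) (2 ∣0)))
  factor≢0 {suc _} _   = _
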